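{- For every index theory $T_I$, the theory $\mathcal{CARDC}(T_I)$ (contiguous arrays with maxdiff and constant arrays) has the strong amalgamation property: whenever $\mathcal M_1,\mathcal M_2$ are models of $\mathcal{CARDC}(T_I)$ and $\mathcal A$ is a common submodel of them, there exist a model $\mathcal M$ of $\mathcal{CARDC}(T_I)$ and embeddings $\mu_1:\mathcal M_1\to\mathcal M$, $\mu_2:\mathcal M_2\to\mathcal M$ whose restrictions to $|\mathcal A|$ coincide and such that, whenever $\mu_1(m_1)=\mu_2(m_2)$ for some $m_1\in|\mathcal M_1|$, $m_2\in|\mathcal M_2|$, there is an element $a\in|\mathcal A|$ with $m_1=a=m_2$.
   Context: All theories are (many-sorted) first-order theories with equality. $|\mathcal M|$ is the support of a structure $\mathcal M$. An embedding is an injective (sort-preserving) map preserving and reflecting the interpretation of all function and relation symbols. A universal theory (all axioms are universal sentences) $T$ has the strong amalgamation property if for all models $\mathcal M_1,\mathcal M_2$ of $T$ with a common submodel $\mathcal A$ there are a model $\mathcal M$ of $T$ and embeddings $\mu_i:\mathcal M_i\to \mathcal M$ ($i=1,2$) agreeing on $|\mathcal A|$ and such that $\mu_1(m_1)=\mu_2(m_2)$ implies $m_1=a=m_2$ for some $a\in|\mathcal A|$. Index theory. An index theory $T_I$ is a mono-sorted theory (its sort is called INDEX) such that: (a) $T_I$ is universal, stably infinite (every $T_I$-satisfiable quantifier-free formula is satisfiable in an infinite model of $T_I$) and has the strong amalgamation property (equivalently, general quantifier-free interpolation); (b) $T_I$-satisfiability of quantifier-free formulae is decidable; (c) $T_I$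 extends the theory of linear (total) orders $\le$ with a distinguished constant $0$. We write $i<j$ for $i\le j\wedge i\ne j$; $\max$ is assumed to be a symbol of $T_I$ (it is definable). The theory $\mathcal{CARD}(T_I)$. Sorts: ARRAY, ELEM, INDEX. Symbols: those of $T_I$ (on INDEX); $rd:\mathrm{ARRAY}\times\mathrm{INDEX}\to\mathrm{ELEM}$; $wr:\mathrm{ARRAY}\times\mathrm{INDEX}\times\mathrm{ELEM}\to\mathrm{ARRAY}$; $\mathtt{diff}:\mathrm{ARRAY}\times\mathrm{ARRAY}\to\mathrm{INDEX}$; $|-|:\mathrm{ARRAY}\to\mathrm{INDEX}$; constants $\bot, el$ of sort ELEM. Axioms: the axioms of $T_I$ and the universal closures of: 1. $|wr(y,i,e)|=|y|$; 2. $wr(y,i,\bot)=y$; 3. $(e\ne\bot\wedge 0\le i\le|y|)\to rd(wr(y,i,e),i)=e$; 4. $i\ne j\to rd(wr(y,i,e),j)=rd(y,j)$; 5. $rd(y,i)\ne\bot\leftrightarrow 0\le i\le|y|$; 6. $|y|\ge 0$; 7. $\mathtt{diff}(y,y)=0$; 8. $x\ne y\to rd(x,\mathtt{diff}(x,y))\ne rd(y,\mathtt{diff}(x,y))$; 9. $\mathtt{diff}(x,y)<i\to rd(x,i)=rd(y,i)$; 10. $\bot\ne el$. The theory $\mathcal{CARDC}(T_I)$ extends $\mathcal{CARD}(T_I)$ with a function symbol $\mathtt{Const}:\mathrm{INDEX}\to\mathrm{ARRAY}$ and the axioms (universally closed): $|\mathtt{Const}(i)|=\max(i,0)$; and $(0\le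 j\wedge j\le|\mathtt{Const}(i)|)\to rd(\mathtt{Const}(i),j)=el$. -}

module Defs where

open import Level using (Level) renaming (suc to lsuc)
open import Data.Empty.Polymorphic using (⊥)
open import Data.Fin.Base using (Fin; toℕ)
open import Data.List.Base using (List; []; _∷_; map)
open import Data.List.Membership.Propositional using (_∈_)
open import Data.List.Membership.Propositional.Properties using (∈-map⁺)
open import Data.List.Relation.Unary.All as All using (All; []; _∷_)
open import Data.List.Relation.Unary.Any as Any using ()
open import Data.Nat.Base using (ℕ; zero; suc; _+_; _*_; _^_; _<_)
open import Data.Product.Base using (Σ; Σ-syntax; ∃-syntax; _×_; _,_)
open import Data.Sum.Base using (_⊎_)
open import Data.Unit.Base using (tt) renaming (⊤ to Unit)
open import Data.Vec.Base as Vec using (Vec)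
open import Data.Vec.Relation.Binary.Pointwise.Inductive using (Pointwise)
open import Function.Bundles using (_⤖_; _⇔_)
open import Function.Definitions using (Injective)
open import Relation.Binary.PropositionalEquality.Core using (_≡_)
open import Relation.Binary.Structures using (IsTotalOrder)
open import Relation.Nullary.Negation.Core using (¬_)

------------------------------------------------------------------------
-- Many-sorted first-order logic with equality

record Signature (S : Set) : Set₁ where
  field
    Fun : List S → S → Set
    Rel : List S → Set

module _ {S : Set} (L : Signature S) where

  open Signature L

  infix  8 _≐_
  infixr 7 _∧_
  infixr 6 _∨_
  infixr 5 _⇒_

  -- Variables are positions in a list of sorts.
  data Term (Γ : List S) : S → Set where
    var : ∀ {s} → s ∈ Γ → Term Γ s
    app : ∀ {Δ s} → Fun Δ s → All (Term Γ) Δ → Term Γ s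

  data QFFormula (Γ : List S) : Set where
    falsum      : QFFormula Γ
    _≐_         : ∀ {s} → Term Γ s → Term Γ s → QFFormula Γ
    rel         : ∀ {Δ} → Rel Δ → All (Term Γ) Δ → QFFormula Γ
    _∧_ _∨_ _⇒_ : QFFormula Γ → QFFormula Γ → QFFormula Γ

  -- The sentence ∀ x₁ : s₁ … ∀ xₙ : sₙ. matrix, where vars = s₁ ∷ … ∷ sₙ ∷ [].
  record UniversalSentence : Set where
    constructor universal
    field
      vars   : List S
      matrix : QFFormula vars

  -- A universal theory is a set of universal sentences.
  UniversalTheory : Set₁
  UniversalTheory = UniversalSentence → Set

  record Structure (ℓ : Level) : Set (lsuc ℓ) where
    field
      Carrier : S → Set ℓ
      ⟦_⟧ᶠ    : ∀ {Δ s} → Fun Δ s → All Carrier Δ → Carrier s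
      ⟦_⟧ʳ    : ∀ {Δ} → Rel Δ → All Carrier Δ → Set ℓ

module _ {S : Set} {L : Signature S} where

  infix  9 ~_
  infixr 5 _⇔ᶠ_

  ~_ : ∀ {Γ} → QFFormula L Γ → QFFormula L Γ
  ~ φ = φ ⇒ falsum

  _⇔ᶠ_ : ∀ {Γ} → QFFormula L Γ → QFFormula L Γ → QFFormula L Γ
  φ ⇔ᶠ ψ = (φ ⇒ ψ) ∧ (ψ ⇒ φ)

  ∀[_] : (Γ : List S) → (All (Term L Γ) Γ → QFFormula L Γ) → UniversalSentence L
  ∀[ Γ ] φ = universal Γ (φ (All.tabulate var))

module _ {S : Set} {L : Signature S} {ℓ : Level} (M : Structure L ℓ) where

  open Structure M

  mutual
    eval : ∀ {Γ s} → All Carrier Γ → Term L Γ s → Carrier s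
    eval ρ (var x)    = All.lookup ρ x
    eval ρ (app f ts) = ⟦ f ⟧ᶠ (evals ρ ts)

    evals : ∀ {Γ Δ} → All Carrier Γ → All (Term L Γ) Δ → All Carrier Δ
    evals ρ []       = []
    evals ρ (t ∷ ts) = eval ρ t ∷ evals ρ ts

  Holds : ∀ {Γ} → All Carrier Γ → QFFormula L Γ → Set ℓ
  Holds ρ falsum     = ⊥
  Holds ρ (t ≐ u)    = eval ρ t ≡ eval ρ u
  Holds ρ (rel R ts) = ⟦ R ⟧ʳ (evals ρ ts)
  Holds ρ (φ ∧ ψ)    = Holds ρ φ × Holds ρ ψ
  Holds ρ (φ ∨ ψ)    = Holds ρ φ ⊎ Holds ρ ψ
  Holds ρ (φ ⇒ ψ)    = Holds ρ φ → Holds ρ ψ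

  True : UniversalSentence L → Set ℓ
  True (universal Γ φ) = (ρ : All Carrier Γ) → Holds ρ φ

  IsModel : UniversalTheory L → Set ℓ
  IsModel T = ∀ {σ} → T σ → True σ

module _ {S : Set} {L : Signature S} where

  record Embedding {ℓ₁ ℓ₂ : Level} (M : Structure L ℓ₁) (N : Structure L ℓ₂) :
                   Set (ℓ₁ Level.⊔ ℓ₂) where
    private
      module M = Structure M
      module N = Structure N
    open Signature L
    field
      to        : ∀ {s} → M.Carrier s → N.Carrier s
      injective : ∀ {s} → Injective _≡_ _≡_ (to {s})
      to-fun    : ∀ {Δ s} (f : Fun Δ s) (xs : All M.Carrier Δ) →
                  to (M.⟦ f ⟧ᶠ xs) ≡ N.⟦ f ⟧ᶠ (All.map to xs)
      to-rel    : ∀ {Δ} (R : Rel Δ) (xs : All M.Carrier Δ) →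
                  M.⟦ R ⟧ʳ xs ⇔ N.⟦ R ⟧ʳ (All.map to xs)

  -- A common submodel of M₁ and M₂ is given by its two inclusions ι₁ and ι₂,
  -- so "m₁ = a = m₂" reads "m₁ ≡ ι₁ a and m₂ ≡ ι₂ a".
  StrongAmalgamation : (ℓ : Level) → UniversalTheory L → Set (lsuc ℓ)
  StrongAmalgamation ℓ T =
    (A M₁ M₂ : Structure L ℓ) → IsModel A T → IsModel M₁ T → IsModel M₂ T →
    (ι₁ : Embedding A M₁) (ι₂ : Embedding A M₂) →
    Σ[ M ∈ Structure L ℓ ] IsModel M T ×
    Σ[ μ₁ ∈ Embedding M₁ M ] Σ[ μ₂ ∈ Embedding M₂ M ]
      (∀ {s} (a : Carrier A s) → to μ₁ (to ι₁ a) ≡ to μ₂ (to ι₂ a)) ×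
      (∀ {s} (m₁ : Carrier M₁ s) (m₂ : Carrier M₂ s) → to μ₁ m₁ ≡ to μ₂ m₂ →
         ∃[ a ] (m₁ ≡ to ι₁ a × m₂ ≡ to ι₂ a))
    where open Structure; open Embedding

  Satisfiable : (ℓ : Level) → UniversalTheory L → ∀ {Γ} → QFFormula L Γ → Set (lsuc ℓ)
  Satisfiable ℓ T {Γ} φ =
    Σ[ M ∈ Structure L ℓ ] IsModel M T ×
    Σ[ ρ ∈ All (Structure.Carrier M) Γ ] Holds M ρ φ

------------------------------------------------------------------------
-- Partial recursive functions

data Rec : ℕ → Set where
  zeroʳ : ∀ {n} → Rec n
  sucʳ  : Rec 1
  proj  : ∀ {n} → Fin n → Rec n
  comp  : ∀ {n m} → Rec m → Vec (Rec n) m → Rec n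
  prec  : ∀ {n} → Rec n → Rec (2 + n) → Rec (suc n)
  μ     : ∀ {n} → Rec (suc n) → Rec n

-- f [ xs ]⇓ y: the computation of f on input xs halts with output y.
data _[_]⇓_ : ∀ {n} → Rec n → Vec ℕ n → ℕ → Set where
  zero⇓     : ∀ {n} {xs : Vec ℕ n} → zeroʳ [ xs ]⇓ 0
  suc⇓      : ∀ {x} → sucʳ [ x Vec.∷ Vec.[] ]⇓ suc x
  proj⇓     : ∀ {n} {xs : Vec ℕ n} {i} → proj i [ xs ]⇓ Vec.lookup xs i
  comp⇓     : ∀ {n m} {f : Rec m} {gs : Vec (Rec n) m} {xs ys z} →
              Pointwise (λ g y → g [ xs ]⇓ y) gs ys → f [ ys ]⇓ z →
              comp f gs [ xs ]⇓ z
  prec-zero : ∀ {n} {f : Rec n} {g xs y} →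
              f [ xs ]⇓ y → prec f g [ 0 Vec.∷ xs ]⇓ y
  prec-suc  : ∀ {n} {f : Rec n} {g xs k y z} →
              prec f g [ k Vec.∷ xs ]⇓ y → g [ k Vec.∷ y Vec.∷ xs ]⇓ z →
              prec f g [ suc k Vec.∷ xs ]⇓ z
  μ⇓        : ∀ {n} {f : Rec (suc n)} {xs y} →
              f [ y Vec.∷ xs ]⇓ 0 →
              (∀ z → z < y → ∃[ w ] f [ z Vec.∷ xs ]⇓ suc w) →
              μ f [ xs ]⇓ y

------------------------------------------------------------------------
-- Decidability of satisfiability for mono-sorted theories

-- An injection into the positive numbers; 0 is left to code the empty list.
⟨_,_⟩ : ℕ → ℕ → ℕ
⟨ x , y ⟩ = 2 ^ x * suc (2 * y)

record SymbolCoding (L : Signature Unit) : Set where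
  open Signature L
  field
    funCode : (Σ[ Δ ∈ List Unit ] Σ[ s ∈ Unit ] Fun Δ s) → ℕ
    relCode : (Σ[ Δ ∈ List Unit ] Rel Δ) → ℕ
    fun-inj : Injective _≡_ _≡_ funCode
    rel-inj : Injective _≡_ _≡_ relCode

module _ {L : Signature Unit} (symbols : SymbolCoding L) {Γ : List Unit} where

  private module Symbols = SymbolCoding symbols

  mutual
    codeTerm : ∀ {s} → Term L Γ s → ℕ
    codeTerm (var x)    = ⟨ 0 , toℕ (Any.index x) ⟩
    codeTerm (app f ts) = ⟨ 1 , ⟨ Symbols.funCode (_ , _ , f) , codeTerms ts ⟩ ⟩

    codeTerms : ∀ {Δ} → All (Term L Γ) Δ → ℕ
    codeTerms []       = 0
    codeTerms (t ∷ ts) = ⟨ codeTerm t , codeTerms ts ⟩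

  codeFormula : QFFormula L Γ → ℕ
  codeFormula falsum     = ⟨ 0 , 0 ⟩
  codeFormula (t ≐ u)    = ⟨ 1 , ⟨ codeTerm t , codeTerm u ⟩ ⟩
  codeFormula (rel R ts) = ⟨ 2 , ⟨ Symbols.relCode (_ , R) , codeTerms ts ⟩ ⟩
  codeFormula (φ ∧ ψ)    = ⟨ 3 , ⟨ codeFormula φ , codeFormula ψ ⟩ ⟩
  codeFormula (φ ∨ ψ)    = ⟨ 4 , ⟨ codeFormula φ , codeFormula ψ ⟩ ⟩
  codeFormula (φ ⇒ ψ)    = ⟨ 5 , ⟨ codeFormula φ , codeFormula ψ ⟩ ⟩

-- Decidability is Turing decidability: Dec (Satisfiable ℓ T φ) would hold
-- of every theory in the presence of excluded middle.
record DecidableSatisfiability {L : Signature Unit} (ℓ : Level)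
                               (T : UniversalTheory L) : Set (lsuc ℓ) where
  field
    coding  : SymbolCoding L
    decider : Rec 1
    accepts : ∀ {Γ} (φ : QFFormula L Γ) → Satisfiable ℓ T φ →
              decider [ codeFormula coding φ Vec.∷ Vec.[] ]⇓ 1
    rejects : ∀ {Γ} (φ : QFFormula L Γ) → ¬ Satisfiable ℓ T φ →
              decider [ codeFormula coding φ Vec.∷ Vec.[] ]⇓ 0

------------------------------------------------------------------------
-- Index theories

Infinite : ∀ {ℓ} → Set ℓ → Set ℓ
Infinite X = ∀ n → ¬ (Fin n ⤖ X)

StablyInfinite : {L : Signature Unit} (ℓ : Level) → UniversalTheory L → Set (lsuc ℓ)
StablyInfinite {L} ℓ T =
  ∀ {Γ} (φ : QFFormula L Γ) → Satisfiable ℓ T φ →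
  Σ[ M ∈ Structure L ℓ ] IsModel M T × Infinite (Structure.Carrier M tt) ×
  Σ[ ρ ∈ All (Structure.Carrier M) Γ ] Holds M ρ φ

module _ {L : Signature Unit} {ℓ : Level} (M : Structure L ℓ) where

  open Signature L
  open Structure M

  Leq : Rel (tt ∷ tt ∷ []) → Carrier tt → Carrier tt → Set ℓ
  Leq leq i j = ⟦ leq ⟧ʳ (i ∷ j ∷ [])

  IsMax : Rel (tt ∷ tt ∷ []) → Fun (tt ∷ tt ∷ []) tt → Set ℓ
  IsMax leq max = ∀ i j → (Leq leq i j → ⟦ max ⟧ᶠ (i ∷ j ∷ []) ≡ j) ×
                          (Leq leq j i → ⟦ max ⟧ᶠ (i ∷ j ∷ []) ≡ i)

record IndexTheory (ℓ : Level) : Set (lsuc ℓ) where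
  field
    language : Signature Unit
  open Signature language public
  field
    leq                : Rel (tt ∷ tt ∷ [])
    zeroᵢ              : Fun [] tt
    max                : Fun (tt ∷ tt ∷ []) tt
    axioms             : UniversalTheory language
    stablyInfinite     : StablyInfinite ℓ axioms
    strongAmalgamation : StrongAmalgamation ℓ axioms
    decidable          : DecidableSatisfiability ℓ axioms
    isTotalOrder       : (M : Structure language ℓ) → IsModel M axioms →
                         IsTotalOrder _≡_ (Leq M leq)
    isMax              : (M : Structure language ℓ) → IsModel M axioms →
                         IsMax M leq max

------------------------------------------------------------------------
-- Contiguous arrays with maxdiff and constant arrays

data Sort : Set where
  ARRAY ELEM INDEX : Sort

module _ {ℓ : Level} (T : IndexTheory ℓ) where

  private module T = IndexTheory T

  indices : List Unit → List Sort
  indices = map (λ _ → INDEX)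

  data ArrayFun : List Sort → Sort → Set where
    index  : ∀ {Δ s} → T.Fun Δ s → ArrayFun (indices Δ) INDEX
    rdˢ    : ArrayFun (ARRAY ∷ INDEX ∷ []) ELEM
    wrˢ    : ArrayFun (ARRAY ∷ INDEX ∷ ELEM ∷ []) ARRAY
    diffˢ  : ArrayFun (ARRAY ∷ ARRAY ∷ []) INDEX
    lenˢ   : ArrayFun (ARRAY ∷ []) INDEX
    constˢ : ArrayFun (INDEX ∷ []) ARRAY
    ⊥ˢ elˢ : ArrayFun [] ELEM

  data ArrayRel : List Sort → Set where
    index : ∀ {Δ} → T.Rel Δ → ArrayRel (indices Δ)

  arrayLanguage : Signature Sort
  arrayLanguage = record { Fun = ArrayFun ; Rel = ArrayRel }

  mutual
    ⌈_⌉ᵗ : ∀ {Γ s} → Term T.language Γ s → Term arrayLanguage (indices Γ) INDEX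
    ⌈ var x ⌉ᵗ    = var (∈-map⁺ (λ _ → INDEX) x)
    ⌈ app f ts ⌉ᵗ = app (index f) ⌈ ts ⌉ᵗˢ

    ⌈_⌉ᵗˢ : ∀ {Γ Δ} → All (Term T.language Γ) Δ →
            All (Term arrayLanguage (indices Γ)) (indices Δ)
    ⌈ [] ⌉ᵗˢ     = []
    ⌈ t ∷ ts ⌉ᵗˢ = ⌈ t ⌉ᵗ ∷ ⌈ ts ⌉ᵗˢ

  ⌈_⌉ᶠ : ∀ {Γ} → QFFormula T.language Γ → QFFormula arrayLanguage (indices Γ)
  ⌈ falsum ⌉ᶠ   = falsum
  ⌈ t ≐ u ⌉ᶠ    = ⌈ t ⌉ᵗ ≐ ⌈ u ⌉ᵗ
  ⌈ rel R ts ⌉ᶠ = rel (index R) ⌈ ts ⌉ᵗˢ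
  ⌈ φ ∧ ψ ⌉ᶠ    = ⌈ φ ⌉ᶠ ∧ ⌈ ψ ⌉ᶠ
  ⌈ φ ∨ ψ ⌉ᶠ    = ⌈ φ ⌉ᶠ ∨ ⌈ ψ ⌉ᶠ
  ⌈ φ ⇒ ψ ⌉ᶠ    = ⌈ φ ⌉ᶠ ⇒ ⌈ ψ ⌉ᶠ

  ⌈_⌉ : UniversalSentence T.language → UniversalSentence arrayLanguage
  ⌈ universal Γ φ ⌉ = universal (indices Γ) ⌈ φ ⌉ᶠ

  module _ {Γ : List Sort} where

    private
      Tm : Sort → Set
      Tm = Term arrayLanguage Γ
      Fm : Set
      Fm = QFFormula arrayLanguage Γ

    infix 8 _≤ᵢ_ _<ᵢ_ 0≤_≤_

    rd : Tm ARRAY → Tm INDEX → Tm ELEM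
    rd y i = app rdˢ (y ∷ i ∷ [])

    wr : Tm ARRAY → Tm INDEX → Tm ELEM → Tm ARRAY
    wr y i e = app wrˢ (y ∷ i ∷ e ∷ [])

    diff : Tm ARRAY → Tm ARRAY → Tm INDEX
    diff x y = app diffˢ (x ∷ y ∷ [])

    ∣_∣ : Tm ARRAY → Tm INDEX
    ∣ y ∣ = app lenˢ (y ∷ [])

    Const : Tm INDEX → Tm ARRAY
    Const i = app constˢ (i ∷ [])

    ⊥ᵉ el : Tm ELEM
    ⊥ᵉ = app ⊥ˢ []
    el = app elˢ []

    0ᵢ : Tm INDEX
    0ᵢ = app (index T.zeroᵢ) []

    maxᵢ : Tm INDEX → Tm INDEX → Tm INDEX
    maxᵢ i j = app (index T.max) (i ∷ j ∷ [])

    _≤ᵢ_ _<ᵢ_ : Tm INDEX → Tm INDEX → Fm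
    i ≤ᵢ j = rel (index T.leq) (i ∷ j ∷ [])
    i <ᵢ j = i ≤ᵢ j ∧ ~ (i ≐ j)

    0≤_≤_ : Tm INDEX → Tm INDEX → Fm
    0≤ i ≤ j = 0ᵢ ≤ᵢ i ∧ i ≤ᵢ j

  -- CARD(T), over the language that already contains Const.
  data CARD : UniversalTheory arrayLanguage where
    index    : ∀ {σ} → T.axioms σ → CARD ⌈ σ ⌉
    len-wr   : CARD (∀[ ARRAY ∷ INDEX ∷ ELEM ∷ [] ] λ { (y ∷ i ∷ e ∷ []) →
                 ∣ wr y i e ∣ ≐ ∣ y ∣ })
    wr-⊥     : CARD (∀[ ARRAY ∷ INDEX ∷ [] ] λ { (y ∷ i ∷ []) →
                 wr y i ⊥ᵉ ≐ y })
    rd-wr-≡  : CARD (∀[ ARRAY ∷ INDEX ∷ ELEM ∷ [] ] λ { (y ∷ i ∷ e ∷ []) →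
                 ~ (e ≐ ⊥ᵉ) ∧ 0≤ i ≤ ∣ y ∣ ⇒ rd (wr y i e) i ≐ e })
    rd-wr-≢  : CARD (∀[ ARRAY ∷ INDEX ∷ INDEX ∷ ELEM ∷ [] ] λ { (y ∷ i ∷ j ∷ e ∷ []) →
                 ~ (i ≐ j) ⇒ rd (wr y i e) j ≐ rd y j })
    rd-≢⊥    : CARD (∀[ ARRAY ∷ INDEX ∷ [] ] λ { (y ∷ i ∷ []) →
                 ~ (rd y i ≐ ⊥ᵉ) ⇔ᶠ 0≤ i ≤ ∣ y ∣ })
    len-≥0   : CARD (∀[ ARRAY ∷ [] ] λ { (y ∷ []) →
                 0ᵢ ≤ᵢ ∣ y ∣ })
    diff-≡   : CARD (∀[ ARRAY ∷ [] ] λ { (y ∷ []) →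
                 diff y y ≐ 0ᵢ })
    diff-≢   : CARD (∀[ ARRAY ∷ ARRAY ∷ [] ] λ { (x ∷ y ∷ []) →
                 ~ (x ≐ y) ⇒ ~ (rd x (diff x y) ≐ rd y (diff x y)) })
    diff-max : CARD (∀[ ARRAY ∷ ARRAY ∷ INDEX ∷ [] ] λ { (x ∷ y ∷ i ∷ []) →
                 diff x y <ᵢ i ⇒ rd x i ≐ rd y i })
    ⊥≢el     : CARD (∀[ [] ] λ _ → ~ (⊥ᵉ ≐ el))

  data CARDC : UniversalTheory arrayLanguage where
    card      : ∀ {σ} → CARD σ → CARDC σ
    len-Const : CARDC (∀[ INDEX ∷ [] ] λ { (i ∷ []) →
                  ∣ Const i ∣ ≐ maxᵢ i 0ᵢ })
    rd-Const  : CARDC (∀[ INDEX ∷ INDEX ∷ [] ] λ { (i ∷ j ∷ []) →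
                  0≤ j ≤ ∣ Const i ∣ ⇒ rd (Const i) j ≐ el })

-- The index parts are amalgamated by hypothesis, in a model I of T_I, and the
-- element parts set-theoretically, with two fresh elements *₁ and *₂. An array
-- b of M₁ has to be extended to the indices outside M₁. If above an index j it
-- agrees, up to finitely many places, with some array a of A, then at j it must
-- take the value of a; otherwise it may take the value el. Arrays b₁ of M₁ and
-- b₂ of M₂ of the same length then have a largest difference, also after
-- finitely many writes, unless they are close to A on the same upper set K of
-- I, K has no minimum, and they agree on K up to finitely many places: the set
-- of their differences below K may have no maximum. Hence I is first extended,
-- by an ultrapower, to a model J of T_I with a sequence c₀ > c₁ > … immediately
-- below each such K, and at the cₙ below its K an array of Mᵢ gets the value
-- *ᵢ. The first cₙ that has not been overwritten is the largest difference.
-- The arrays of the amalgam are the finite modifications of these extensions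
-- and of the constant arrays.
module Submission where

open import Axiom.ExcludedMiddle using (ExcludedMiddle)
open import Axiom.Extensionality.Propositional using (Extensionality)
open import Defs hiding (rd; wr; diff; ∣_∣; Const; ⊥ᵉ; el; 0ᵢ; maxᵢ; _≤ᵢ_; _<ᵢ_; 0≤_≤_)
open import Data.Bool.Base using (Bool; true; false)
open import Data.Empty using (⊥-elim-irr)
open import Data.Empty.Polymorphic using (⊥-elim)
open import Data.List.Base using (List; []; _∷_; _++_)
open import Data.List.Membership.Propositional using (_∈_; _∉_)
open import Data.List.Membership.Propositional.Properties using (∈-++⁺ˡ; ∈-++⁺ʳ; ∈-++⁻; ∈-map⁺)
open import Data.List.Relation.Unary.All as All using (All; []; _∷_)
open import Data.List.Relation.Unary.All.Properties as All using ()
open import Data.List.Relation.Unary.Any using (here; there)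
open import Data.Nat.Base as ℕ using (ℕ; zero; suc; _⊔_)
open import Data.Nat.Induction using (<-wellFounded)
open import Data.Nat.Properties as ℕ using ()
open import Induction.WellFounded using (Acc; acc)
open import Data.Product.Base using (Σ-syntax; ∃; ∃-syntax; _×_; _,_; proj₁; proj₂)
open import Data.Product.Function.NonDependent.Propositional using (_×-⇔_)
open import Data.Sum.Base using (_⊎_; inj₁; inj₂; [_,_]′)
open import Data.Sum.Function.Propositional using (_⊎-⇔_)
open import Data.Unit.Base using (tt) renaming (⊤ to Unit)
open import Function.Base using (_∘_; id; case_of_)
open import Function.Bundles using (_⇔_; mk⇔; Equivalence)
open import Function.Related.TypeIsomorphisms using (→-cong-⇔)
open import Level using (Setω; Lift; lift; lower) renaming (suc to lsuc)
open import Relation.Binary.PropositionalEquality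
  using (_≡_; _≢_; refl; sym; trans; cong; cong₂; subst; subst₂)
open import Relation.Binary.Structures using (IsTotalOrder)
open import Relation.Nullary using (¬_; Dec; yes; no; does; contradiction)
open import Relation.Nullary.Decidable using (dec-true; decidable-stable; recompute)

open Structure using (Carrier)
open Embedding using (to)

-- The obstacle is `diff`: two arrays of the amalgam must still have a largest difference after any
-- finite number of writes. Two arrays of equal length on one side have it for free, at an index of
-- that side, since `wr` removes the overwritten indices and `diff` finds the rest. A mixed pair is
-- reduced to this case wherever one array is close to an array of A, as the latter lives on both
-- sides. That `K` has no minimum comes from `diff` as well. If an array `a` of A has the length of
-- `b`, the largest difference of the two can be added to the finite exceptions, so `b` is near A
-- from that index on; if `b` is not near everywhere, repeating this outside ever larger finite sets
-- never stops. Such an `a` exists because arrays of equal length on different sides have their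
-- length in A, and `Const` turns it into an array. Strongness on arrays: if extensions from the two
-- sides coincide, no stars can occur, so the arrays are near A everywhere. The exceptions at
-- indices of A are repaired by writes inside A; a remaining largest difference would occur at the
-- same place on both sides, hence at an index of A, where none is left.

EM : Setω
EM = ∀ {a} → ExcludedMiddle a

Ext : Setω
Ext = ∀ {a b} → Extensionality a b

-- Classical logic and Boolean predicates

module Truth (em : EM) where

  -- Sets that are collected or compared are Boolean predicates: they stay at the universe level of
  -- their elements, and extensionality makes sets with the same members equal.
  char : ∀ {a} → Set a → Bool
  char P = does (em {P = P})

  char⁺ : ∀ {a} {P : Set a} → P → char P ≡ true
  char⁺ {P = P} = dec-true (em {P = P})

  char⁻ : ∀ {a} {P : Set a} → char P ≡ true → P
  char⁻ {P = P} eq with em {P = P}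
  ... | yes p = p

  bool-cong : ∀ {p q : Bool} → (p ≡ true → q ≡ true) → (q ≡ true → p ≡ true) → p ≡ q
  bool-cong {true}  {q}     f g = sym (f refl)
  bool-cong {false} {false} f g = refl
  bool-cong {false} {true}  f g = g refl

  stable : ∀ {a} {P : Set a} → ¬ ¬ P → P
  stable = decidable-stable em

-- Maximal families of finite character

-- The Teichmüller–Tukey lemma, by the Bourbaki–Witt argument: the tower of
-- families obtained from ∅ by adding compatible elements one at a time and
-- taking unions is a chain, and its union is maximal.
module Tukey (em : EM) (ext : Ext) {ℓ} {Y : Set ℓ}
             (Consistent : List Y → Set ℓ) (consistent-[] : Consistent []) where

  open Truth em

  Family : Set ℓ
  Family = Y → Bool

  infix 4 _∋_ _⊆_

  _∋_ : Family → Y → Set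
  F ∋ y = F y ≡ true

  _⊆_ : Family → Family → Set ℓ
  F ⊆ G = ∀ y → F ∋ y → G ∋ y

  ⊆-antisym : ∀ {F G} → F ⊆ G → G ⊆ F → F ≡ G
  ⊆-antisym F⊆G G⊆F = ext λ y → bool-cong (F⊆G y) (G⊆F y)

  FinitelyConsistent : Family → Set ℓ
  FinitelyConsistent F = ∀ L → All (F ∋_) L → Consistent L

  insert : Family → Y → Family
  insert F y z = char (F ∋ z ⊎ z ≡ y)

  Extensible : Family → Set ℓ
  Extensible F = ∃[ y ] (¬ F ∋ y × FinitelyConsistent (insert F y))

  -- Excluded middle for the Σ-type `Extensible F` yields an actual witness, and so serves as the
  -- choice function.
  next : Family → Family
  next F with em {P = Extensible F}
  ... | yes (y , _) = insert F y
  ... | no  _       = F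

  ⊆-next : ∀ F → F ⊆ next F
  ⊆-next F z F∋z with em {P = Extensible F}
  ... | yes _ = char⁺ (inj₁ F∋z)
  ... | no  _ = F∋z

  ⋃ : (Family → Bool) → Family
  ⋃ Q y = char (∃[ F ] (Q F ≡ true × F ∋ y))

  data Tower : Family → Set ℓ where
    step : ∀ {F} → Tower F → Tower (next F)
    sup  : ∀ Q → (∀ F → Q F ≡ true → Tower F) → Tower (⋃ Q)

  ⊆-⋃ : ∀ {Q F} → Q F ≡ true → F ⊆ ⋃ Q
  ⊆-⋃ q y F∋y = char⁺ (_ , q , F∋y)

  ⋃-⊆ : ∀ {Q G} → (∀ F → Q F ≡ true → F ⊆ G) → ⋃ Q ⊆ G
  ⋃-⊆ h y ∋y with char⁻ ∋y
  ... | F , q , F∋y = h F q y F∋y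

  ⋃-escapes : ∀ {Q G} → ¬ ⋃ Q ⊆ G → ∃[ F ] (Q F ≡ true × ¬ F ⊆ G)
  ⋃-escapes {Q} {G} ¬⊆ = stable λ ¬∃ →
    ¬⊆ (⋃-⊆ λ F q → stable λ F⊈G → ¬∃ (F , q , F⊈G))

  -- The extreme points of the Bourbaki-Witt argument: `extreme-compare` makes them comparable with
  -- the whole tower, and `tower-extreme` shows that the tower has no other members.
  Extreme : Family → Set ℓ
  Extreme C = ∀ {F} → Tower F → F ⊆ C → ¬ C ⊆ F → next F ⊆ C

  extreme-compare : ∀ {C F} → Extreme C → Tower F → F ⊆ C ⊎ next C ⊆ F
  extreme-compare {C} ex (step {F} t) with extreme-compare ex t
  ... | inj₂ C⁺⊆F = inj₂ λ y → ⊆-next F y ∘ C⁺⊆F y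
  ... | inj₁ F⊆C with em {P = C ⊆ F}
  ...   | no  C⊈F = inj₁ (ex t F⊆C C⊈F)
  ...   | yes C⊆F = inj₂ λ y → subst (λ G → next G ∋ y) (⊆-antisym C⊆F F⊆C)
  extreme-compare {C} ex (sup Q ts) with em {P = ⋃ Q ⊆ C}
  ... | yes ⊆C = inj₁ ⊆C
  ... | no ⊈C with ⋃-escapes ⊈C
  ...   | F , q , F⊈C with extreme-compare ex (ts F q)
  ...     | inj₁ F⊆C  = contradiction F⊆C F⊈C
  ...     | inj₂ C⁺⊆F = inj₂ λ y → ⊆-⋃ q y ∘ C⁺⊆F y

  tower-extreme : ∀ {C} → Tower C → Extreme C
  tower-extreme (step {C} t) {F} u F⊆C⁺ C⁺⊈F with extreme-compare (tower-extreme t) u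
  ... | inj₂ C⁺⊆F = contradiction C⁺⊆F C⁺⊈F
  ... | inj₁ F⊆C with em {P = C ⊆ F}
  ...   | no  C⊈F = λ y → ⊆-next C y ∘ tower-extreme t u F⊆C C⊈F y
  ...   | yes C⊆F = λ y → subst (λ G → next G ∋ y) (⊆-antisym F⊆C C⊆F)
  tower-extreme (sup Q ts) {F} u F⊆⋃ ⋃⊈F with ⋃-escapes ⋃⊈F
  ... | P , q , P⊈F with extreme-compare (tower-extreme (ts P q)) u
  ...   | inj₂ P⁺⊆F = contradiction (λ y → P⁺⊆F y ∘ ⊆-next P y) P⊈F
  ...   | inj₁ F⊆P  = λ y → ⊆-⋃ q y ∘ tower-extreme (ts P q) u F⊆P P⊈F y

  chain : ∀ {F G} → Tower F → Tower G → F ⊆ G ⊎ G ⊆ F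
  chain {F} {G} t u with extreme-compare (tower-extreme u) t
  ... | inj₁ F⊆G  = inj₁ F⊆G
  ... | inj₂ G⁺⊆F = inj₂ λ y → G⁺⊆F y ∘ ⊆-next G y

  -- The tower is a chain, so among the finitely many witnessing families one contains the others.
  -- The list is nonempty because `Q` may be empty.
  common-member : ∀ {Q} → (∀ F → Q F ≡ true → Tower F) →
                  ∀ y L → All (⋃ Q ∋_) (y ∷ L) → ∃[ F ] (Q F ≡ true × All (F ∋_) (y ∷ L))
  common-member ts y [] (∋y ∷ []) with char⁻ ∋y
  ... | F , q , F∋y = F , q , F∋y ∷ []
  common-member ts y (z ∷ L) (∋y ∷ ∋L) with char⁻ ∋y | common-member ts z L ∋L
  ... | F , q , F∋y | G , r , G∋L with chain (ts F q) (ts G r)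
  ...   | inj₁ F⊆G = G , r , F⊆G _ F∋y ∷ G∋L
  ...   | inj₂ G⊆F = F , q , F∋y ∷ All.map (G⊆F _) G∋L

  tower-consistent : ∀ {F} → Tower F → FinitelyConsistent F
  tower-consistent (step {F} t) with em {P = Extensible F}
  ... | yes (_ , _ , con) = con
  ... | no  _             = tower-consistent t
  tower-consistent (sup Q ts) []      _  = consistent-[]
  tower-consistent (sup Q ts) (y ∷ L) ∋L with common-member ts y L ∋L
  ... | F , q , F∋L = tower-consistent (ts F q) (y ∷ L) F∋L

  abstract

    maximal : Family
    maximal = ⋃ (λ F → char (Tower F))

    maximal-tower : Tower maximal
    maximal-tower = sup _ λ _ → char⁻

    maximal-consistent : FinitelyConsistent maximal
    maximal-consistent = tower-consistent maximal-tower

    next-maximal : next maximal ⊆ maximal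
    next-maximal = ⊆-⋃ (char⁺ (step maximal-tower))

    inextensible : ∀ {F} → next F ⊆ F → ¬ Extensible F
    inextensible {F} F⁺⊆F extensible with em {P = Extensible F}
    ... | yes (y , F∌y , _) = F∌y (F⁺⊆F y (char⁺ (inj₂ refl)))
    ... | no  ¬extensible   = ¬extensible extensible

    maximal-maximal : ∀ y → FinitelyConsistent (insert maximal y) → maximal ∋ y
    maximal-maximal y con = stable λ ∌y → inextensible next-maximal (y , ∌y , con)

-- Ultrafilters and ultrapowers

-- An ultrafilter on List I containing {x ∣ i ∈ x} for every i.
module Ultrafilter (em : EM) (ext : Ext) {ℓ} (I : Set ℓ) where

  open Truth em

  infix 4 _⊑_

  _⊑_ : List I → List I → Set ℓ
  l ⊑ x = ∀ i → i ∈ l → i ∈ x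

  -- Every finite intersection has to meet the cone above each list `l`, so adding a cone never
  -- destroys consistency, and all cones end up in the maximal family.
  Meets : List (List I → Bool) → Set ℓ
  Meets L = ∀ l → ∃[ x ] (l ⊑ x × All (λ S → S x ≡ true) L)

  open Tukey em ext Meets (λ l → l , (λ _ → id) , [])

  without-inserted : ∀ {F S} L → All (insert F S ∋_) L →
                     ∃[ L′ ] (All (F ∋_) L′ ×
                       (∀ {x} → S x ≡ true → All (λ T → T x ≡ true) L′ → All (λ T → T x ≡ true) L))
  without-inserted []      []         = [] , [] , λ _ _ → []
  without-inserted (T ∷ L) (∋T ∷ ∋L) with without-inserted L ∋L | char⁻ ∋T
  ... | L′ , ∋L′ , h | inj₁ F∋T  = T ∷ L′ , F∋T ∷ ∋L′ , λ { s (t ∷ ts) → t ∷ h s ts }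
  ... | L′ , ∋L′ , h | inj₂ refl = L′ , ∋L′ , λ s ts → s ∷ h s ts

  abstract

    Large : (List I → Set ℓ) → Set
    Large P = maximal ∋ (λ x → char (P x))

    large⁺ : ∀ {P : List I → Set ℓ} →
             (∀ L → All (maximal ∋_) L → ∀ l →
               ∃[ x ] (l ⊑ x × P x × All (λ S → S x ≡ true) L)) →
             Large P
    large⁺ h = maximal-maximal _ λ L ∋L l → case without-inserted L ∋L of λ
      { (L′ , ∋L′ , k) → case h L′ ∋L′ l of λ { (x , l⊆x , p , q) → x , l⊆x , k (char⁺ p) q } }

    large⁻ : ∀ {P : List I → Set ℓ} → Large P → ∀ L → All (maximal ∋_) L → ∀ l →
             ∃[ x ] (l ⊑ x × P x × All (λ S → S x ≡ true) L)
    large⁻ large L ∋L l with maximal-consistent (_ ∷ L) (large ∷ ∋L) l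
    ... | x , l⊆x , p ∷ q = x , l⊆x , char⁻ p , q

    large-zip : ∀ {P Q R : List I → Set ℓ} → (∀ {x} → P x → Q x → R x) →
                Large P → Large Q → Large R
    large-zip f largeP largeQ = large⁺ λ L ∋L l → case large⁻ largeP (_ ∷ L) (largeQ ∷ ∋L) l of λ
      { (x , l⊆x , p , q ∷ r) → x , l⊆x , f p (char⁻ q) , r }

  large-map : ∀ {P Q : List I → Set ℓ} → (∀ {x} → P x → Q x) → Large P → Large Q
  large-map f large = large⁺ λ L ∋L l → case large⁻ large L ∋L l of λ
    { (x , l⊆x , p , q) → x , l⊆x , f p , q }

  large-pure : ∀ {P : List I → Set ℓ} → (∀ {x} → P x) → Large P
  large-pure p = large⁺ λ L ∋L l → case maximal-consistent L ∋L l of λ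
    { (x , l⊆x , q) → x , l⊆x , p , q }

  large-∈ : ∀ i → Large (i ∈_)
  large-∈ i = large⁺ λ L ∋L l → case maximal-consistent L ∋L (i ∷ l) of λ
    { (x , l⊆x , q) → x , (λ j → l⊆x j ∘ there) , l⊆x i (here refl) , q }

  large-inhabited : ∀ {P : List I → Set ℓ} → Large P → ∃ P
  large-inhabited large with large⁻ large [] [] []
  ... | x , _ , p , _ = x , p

  -- If some finite intersection, within some cone, misses the complement of `P`, it is contained in
  -- `P` there; then `P` is consistent with the maximal family, hence large.
  large-¬ : ∀ {P : List I → Set ℓ} → ¬ Large P → Large (λ x → ¬ P x)
  large-¬ {P} ¬large = large⁺ λ L ∋L l → stable λ ¬meets → ¬large (large⁺ λ L′ ∋L′ l′ →
    case maximal-consistent (L ++ L′) (All.++⁺ ∋L ∋L′) (l ++ l′) of λ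
      { (x , l⊆x , q) → x , (λ i → l⊆x i ∘ ∈-++⁺ʳ l) ,
          stable (λ ¬p → ¬meets (x , (λ i → l⊆x i ∘ ∈-++⁺ˡ) , ¬p , All.++⁻ˡ L q)) , All.++⁻ʳ L q })

module Ultrapower (em : EM) (ext : Ext) {ℓ} (I : Set ℓ) where

  open Truth em
  open Ultrafilter em ext I

  module _ {B : Set ℓ} where

    infix 4 _~_

    _~_ : (f g : List I → B) → Set
    f ~ g = Large (λ x → f x ≡ g x)

    ~-refl : ∀ {f} → f ~ f
    ~-refl = large-pure refl

    ~-sym : ∀ {f g} → f ~ g → g ~ f
    ~-sym = large-map sym

    ~-trans : ∀ {f g h} → f ~ g → g ~ h → f ~ h
    ~-trans = large-zip trans

    class : (List I → B) → (List I → B) → Bool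
    class f g = char (f ~ g)

    abstract

      -- The proof of inhabitation is irrelevant, so the choice depends on the class `p` alone;
      -- equivalent sequences have equal classes and therefore one representative.
      choose : (p : (List I → B) → Bool) → .(∃[ g ] p g ≡ true) → ∃[ g ] p g ≡ true
      choose p w with em {P = ∃[ g ] p g ≡ true}
      ... | yes w′ = w′
      ... | no ¬w  = ⊥-elim-irr (¬w w)

      canonical : (List I → B) → (List I → B)
      canonical f = proj₁ (choose (class f) (f , char⁺ ~-refl))

      canonical-~ : ∀ f → f ~ canonical f
      canonical-~ f = char⁻ (proj₂ (choose (class f) (f , char⁺ ~-refl)))

      choose-cong : ∀ {p q} → p ≡ q → .(w : ∃[ g ] p g ≡ true) .(w′ : ∃[ g ] q g ≡ true) →
                    proj₁ (choose p w) ≡ proj₁ (choose q w′)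
      choose-cong refl w w′ = refl

      canonical-cong : ∀ {f g} → f ~ g → canonical f ≡ canonical g
      canonical-cong f~g = choose-cong
        (ext λ h → bool-cong (λ f~h → char⁺ (~-trans (~-sym f~g) (char⁻ f~h)))
                             (λ g~h → char⁺ (~-trans f~g (char⁻ g~h)))) _ _

  -- Quotients by representatives: EM for types picks one element of each class.
  record Power (B : Set ℓ) : Set ℓ where
    constructor power
    field
      rep            : List I → B
      .rep-canonical : canonical rep ≡ rep

  open Power public

  infix 5 _at_

  _at_ : ∀ {S : Set} {C : S → Set ℓ} {Γ} → All (Power ∘ C) Γ → List I → All C Γ
  ps at x = All.map (λ p → rep p x) ps

  module _ {B : Set ℓ} where

    [_] : (List I → B) → Power B
    [ f ] = power (canonical f) (sym (canonical-cong (canonical-~ f)))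

    rep-[] : ∀ f → rep [ f ] ~ f
    rep-[] f = ~-sym (canonical-~ f)

    power-≡ : ∀ {p q : Power B} → rep p ~ rep q → p ≡ q
    power-≡ {power f cf} {power g cg} f~g
      with trans (sym (recompute em cf)) (trans (canonical-cong f~g) (recompute em cg))
    ... | refl = refl

  module _ {S : Set} {L : Signature S} (M : Structure L ℓ) where

    private module M = Structure M

    ultrapower : Structure L ℓ
    ultrapower = record
      { Carrier = Power ∘ M.Carrier
      ; ⟦_⟧ᶠ    = λ f ps → [ (λ x → M.⟦ f ⟧ᶠ (ps at x)) ]
      ; ⟦_⟧ʳ    = λ R ps → Lift ℓ (Large (λ x → M.⟦ R ⟧ʳ (ps at x)))
      }

    mutual
      eval-at : ∀ {Γ s} (ρ : All (Power ∘ M.Carrier) Γ) (t : Term L Γ s) →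
                Large λ x → rep (eval ultrapower ρ t) x ≡ eval M (ρ at x) t
      eval-at ρ (var v)    = large-pure (sym (All.lookup-map ρ v))
      eval-at ρ (app f ts) =
        large-zip (λ p q → trans p (cong M.⟦ f ⟧ᶠ q)) (rep-[] _) (evals-at ρ ts)

      evals-at : ∀ {Γ Δ} (ρ : All (Power ∘ M.Carrier) Γ) (ts : All (Term L Γ) Δ) →
                 Large λ x → (evals ultrapower ρ ts at x) ≡ evals M (ρ at x) ts
      evals-at ρ []       = large-pure refl
      evals-at ρ (t ∷ ts) = large-zip (cong₂ _∷_) (eval-at ρ t) (evals-at ρ ts)

    -- Only `∨` and `⇒` need an ultrafilter rather than a filter, through `large-¬`. The
    -- quantifier-free case is enough for universal axioms, which then hold coordinatewise.
    łoś : ∀ {Γ} (ρ : All (Power ∘ M.Carrier) Γ) (φ : QFFormula L Γ) →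
          Holds ultrapower ρ φ ⇔ Large (λ x → Holds M (ρ at x) φ)
    łoś ρ falsum = mk⇔ (λ ()) λ l → case large-inhabited l of λ ()
    łoś ρ (t ≐ u) = mk⇔
      (λ eq → large-zip (λ p q → trans (sym p) q) (eval-at ρ t)
                (subst (λ p → Large λ x → rep p x ≡ _) (sym eq) (eval-at ρ u)))
      (λ l → power-≡ (~-trans (large-zip trans (eval-at ρ t) l) (~-sym (eval-at ρ u))))
    łoś ρ (rel R ts) = mk⇔
      (λ l → large-zip (subst M.⟦ R ⟧ʳ) (evals-at ρ ts) (lower l))
      (λ l → lift (large-zip (subst M.⟦ R ⟧ʳ ∘ sym) (evals-at ρ ts) l))
    łoś ρ (φ ∧ ψ) = mk⇔
      (λ { (p , q) → large-zip _,_ (φ.to p) (ψ.to q) })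
      (λ l → φ.from (large-map proj₁ l) , ψ.from (large-map proj₂ l))
      where
      module φ = Equivalence (łoś ρ φ)
      module ψ = Equivalence (łoś ρ ψ)
    łoś ρ (φ ∨ ψ) = mk⇔
      [ large-map inj₁ ∘ φ.to , large-map inj₂ ∘ ψ.to ]′
      (λ l → case em {P = Large (λ x → Holds M (ρ at x) φ)} of λ
        { (yes p) → inj₁ (φ.from p)
        ; (no ¬p) → inj₂ (ψ.from (large-zip
            (λ ¬p → [ (λ p → contradiction p ¬p) , id ]′) (large-¬ ¬p) l)) })
      where
      module φ = Equivalence (łoś ρ φ)
      module ψ = Equivalence (łoś ρ ψ)
    łoś ρ (φ ⇒ ψ) = mk⇔
      (λ h → case em {P = Large (λ x → Holds M (ρ at x) φ)} of λ
        { (yes p) → large-map (λ q _ → q) (ψ.to (h (φ.from p)))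
        ; (no ¬p) → large-map (λ ¬p p → contradiction p ¬p) (large-¬ ¬p) })
      (λ l p → ψ.from (large-zip (λ h → h) l (φ.to p)))
      where
      module φ = Equivalence (łoś ρ φ)
      module ψ = Equivalence (łoś ρ ψ)

    ultrapower-model : ∀ {T : UniversalTheory L} → IsModel M T → IsModel ultrapower T
    ultrapower-model model {universal Γ φ} σ∈T ρ =
      Equivalence.from (łoś ρ φ) (large-pure λ {x} → model σ∈T (ρ at x))

    constant : ∀ {s} → M.Carrier s → Power (M.Carrier s)
    constant m = [ (λ _ → m) ]

    constant-at : ∀ {Δ} (ms : All M.Carrier Δ) →
                  Large λ x → (All.map constant ms at x) ≡ ms
    constant-at []       = large-pure refl
    constant-at (m ∷ ms) = large-zip (cong₂ _∷_) (rep-[] _) (constant-at ms)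

    diagonal : Embedding M ultrapower
    diagonal = record
      { to        = constant
      ; injective = λ {_} {_} {n} eq → proj₂ (large-inhabited
          (~-trans (~-sym (rep-[] _)) (subst (λ p → rep p ~ (λ _ → n)) (sym eq) (rep-[] _))))
      ; to-fun    = λ f ms → power-≡ (~-trans (rep-[] _) (~-trans
          (large-map (cong M.⟦ f ⟧ᶠ ∘ sym) (constant-at ms)) (~-sym (rep-[] _))))
      ; to-rel    = λ R ms → mk⇔
          (λ r → lift (large-map (λ eq → subst M.⟦ R ⟧ʳ (sym eq) r) (constant-at ms)))
          (λ l → proj₂ (large-inhabited (large-zip (subst M.⟦ R ⟧ʳ) (constant-at ms) (lower l))))
      }

-- Index models and the filling of cuts

-- IsModel as a record, to spare the implicit sentence of IsModel.
infix 4 _⊨_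

record _⊨_ {S : Set} {L : Signature S} {ℓ} (M : Structure L ℓ) (T : UniversalTheory L) : Set ℓ where
  constructor satisfying
  field
    satisfies : IsModel M T

open _⊨_ using (satisfies)

-- In a total order x < y is taken to mean ¬ (y ≤ x), so that every embedding
-- visibly preserves and reflects it.
module TotalOrder (em : EM) {a ℓ} {A : Set a} {_≤_ : A → A → Set ℓ}
                  (isTotalOrder : IsTotalOrder _≡_ _≤_) where

  open Truth em
  open IsTotalOrder isTotalOrder public
    using (antisym; total) renaming (refl to ≤-refl; trans to ≤-trans)

  infix 4 _<_

  _<_ : A → A → Set ℓ
  x < y = ¬ y ≤ x

  <-irrefl : ∀ {x} → ¬ x < x
  <-irrefl x<x = x<x ≤-refl

  <⇒≤ : ∀ {x y} → x < y → x ≤ y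
  <⇒≤ {x} {y} x<y = [ id , (λ y≤x → contradiction y≤x x<y) ]′ (total x y)

  <⇒≢ : ∀ {x y} → x < y → x ≢ y
  <⇒≢ x<x refl = <-irrefl x<x

  ≮⇒≥ : ∀ {x y} → ¬ x < y → y ≤ x
  ≮⇒≥ = stable

  <-≤-trans : ∀ {x y z} → x < y → y ≤ z → x < z
  <-≤-trans x<y y≤z z≤x = x<y (≤-trans y≤z z≤x)

  ≤-<-trans : ∀ {x y z} → x ≤ y → y < z → x < z
  ≤-<-trans x≤y y<z z≤x = y<z (≤-trans z≤x x≤y)

  <-trans : ∀ {x y z} → x < y → y < z → x < z
  <-trans x<y y<z = <-≤-trans x<y (<⇒≤ y<z)

module IndexModel (em : EM) {ℓ} (T : IndexTheory ℓ)
                  (M : Structure (IndexTheory.language T) ℓ)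
                  (model : M ⊨ IndexTheory.axioms T) where

  private module T = IndexTheory T

  Index : Set ℓ
  Index = Carrier M tt

  infix 4 _≤_

  _≤_ : Index → Index → Set ℓ
  _≤_ = Leq M T.leq

  isTotalOrder : IsTotalOrder _≡_ _≤_
  isTotalOrder = T.isTotalOrder M (satisfies model)

  isMax : IsMax M T.leq T.max
  isMax = T.isMax M (satisfies model)

  open TotalOrder em isTotalOrder public

  Gap : (Index → Bool) → Set ℓ
  Gap K = (∃[ k ] K k ≡ true) × (∀ k → K k ≡ true → ∃[ k′ ] (K k′ ≡ true × k′ < k))

  UpperSet : (Index → Bool) → Set ℓ
  UpperSet K = ∀ {i j} → K i ≡ true → i ≤ j → K j ≡ true

-- An extension in which every upper set K without minimum gets infinitely many
-- new elements immediately below it.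
record CutFilling (em : EM) {ℓ} (T : IndexTheory ℓ)
                  (I : Structure (IndexTheory.language T) ℓ)
                  (model : I ⊨ IndexTheory.axioms T) : Set (lsuc ℓ) where
  private module I = IndexModel em T I model
  field
    J       : Structure (IndexTheory.language T) ℓ
    J-model : J ⊨ IndexTheory.axioms T
    ε       : Embedding I J
  private module J = IndexModel em T J J-model
  field
    cut         : (I.Index → Bool) → ℕ → J.Index
    cut-descend : ∀ {K} → I.Gap K → ∀ n → cut K (suc n) J.< cut K n
    cut-below   : ∀ {K} → I.Gap K → ∀ n {k} → K k ≡ true → cut K n J.< to ε k
    cut-above   : ∀ {K} → I.Gap K → I.UpperSet K → ∀ n {i} → K i ≢ true → to ε i J.< cut K n

module CutFillingConstruction (em : EM) (ext : Ext) {ℓ} (T : IndexTheory ℓ)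
                              (I : Structure (IndexTheory.language T) ℓ)
                              (model : I ⊨ IndexTheory.axioms T) where

  open Truth em
  open IndexModel em T I model
  open Ultrafilter em ext Index
  open Ultrapower em ext Index
  private module T = IndexTheory T

  extension-model : ultrapower I ⊨ T.axioms
  extension-model = satisfying λ {σ} → ultrapower-model I {T = T.axioms} (satisfies model) {σ}

  private module J = IndexModel em T (ultrapower I) extension-model

  below : ∀ {K} → Gap K → (l : List Index) →
          ∃[ k ] (K k ≡ true × (∀ {i} → i ∈ l → K i ≡ true → k < i))
  below gap [] with proj₁ gap
  ... | k , k∈K = k , k∈K , λ ()
  below {K} gap (j ∷ l) with below gap l
  ... | k , k∈K , k<l with em {P = K j ≡ true × j ≤ k}
  ...   | no ¬p = k , k∈K , λ
          { (here refl) j∈K j≤k → ¬p (j∈K , j≤k) ; (there i∈l) → k<l i∈l }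
  ...   | yes (j∈K , j≤k) with proj₂ gap j j∈K
  ...     | k′ , k′∈K , k′<j = k′ , k′∈K , λ
          { (here refl) _   → k′<j
          ; (there i∈l) i∈K → <-trans k′<j (≤-<-trans j≤k (k<l i∈l i∈K)) }

  -- Read as a function of `l`, the n-th term represents an element of the ultrapower. It lies below
  -- each `k` of `K`, since the lists containing `k` are large and the start is below every member
  -- of `K` in `l`; it lies above all indices outside `K` because its values stay in `K`.
  descending : ∀ {K} → Gap K → List Index → ℕ → ∃[ k ] K k ≡ true
  descending gap l zero    with below gap l
  ... | k , k∈K , _ = k , k∈K
  descending gap l (suc n) with descending gap l n
  ... | k , k∈K with proj₂ gap k k∈K
  ...   | k′ , k′∈K , _ = k′ , k′∈K

  descending-< : ∀ {K} (gap : Gap K) l n →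
                 proj₁ (descending gap l (suc n)) < proj₁ (descending gap l n)
  descending-< gap l n with descending gap l n
  ... | k , k∈K with proj₂ gap k k∈K
  ...   | k′ , k′∈K , k′<k = k′<k

  descending-below : ∀ {K} (gap : Gap K) l n {i} → i ∈ l → K i ≡ true →
                     proj₁ (descending gap l n) < i
  descending-below gap l zero    with below gap l
  ... | k , k∈K , k<l = k<l
  descending-below gap l (suc n) i∈l i∈K =
    <-trans (descending-< gap l n) (descending-below gap l n i∈l i∈K)

  approximation : (Index → Bool) → ℕ → List Index → Index
  approximation K n l with em {P = Gap K}
  ... | yes gap = proj₁ (descending gap l n)
  ... | no  _   = Structure.⟦_⟧ᶠ I T.zeroᵢ []

  -- The proof of `Gap K` found by `em` need not be the given one, and `descending` depends on it;
  -- the estimates must use the proof returned here.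
  approximation-gap : ∀ {K} → Gap K → Σ[ gap ∈ Gap K ]
                      (∀ n l → approximation K n l ≡ proj₁ (descending gap l n))
  approximation-gap {K} gap with em {P = Gap K}
  ... | yes gap′ = gap′ , λ _ _ → refl
  ... | no ¬gap  = contradiction gap ¬gap

  []-< : ∀ {f g} → Large (λ l → f l < g l) → [ f ] J.< [ g ]
  []-< {f} {g} f<g (lift g≤f) with large-inhabited
    (large-zip _,_ f<g (large-zip _,_ g≤f (large-zip _,_ (rep-[] f) (rep-[] g))))
  ... | l , f<g , g≤f , p , q = f<g (subst₂ _≤_ q p g≤f)

  cutFilling : CutFilling em T I model
  cutFilling = record
    { J           = ultrapower I
    ; J-model     = extension-model
    ; ε           = diagonal I
    ; cut         = λ K n → [ approximation K n ]
    ; cut-descend = λ gap n → case approximation-gap gap of λ { (gap′ , eq) →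
        []-< (large-pure λ {l} → subst₂ _<_ (sym (eq (suc n) l)) (sym (eq n l))
                                   (descending-< gap′ l n)) }
    ; cut-below   = λ gap n {k} k∈K → case approximation-gap gap of λ { (gap′ , eq) →
        []-< (large-map (λ {l} k∈l → subst (_< k) (sym (eq n l))
                                       (descending-below gap′ l n k∈l k∈K)) (large-∈ k)) }
    ; cut-above   = λ gap up n {i} i∉K → case approximation-gap gap of λ { (gap′ , eq) →
        []-< (large-pure λ {l} → subst (i <_) (sym (eq n l)) λ ≤i →
                i∉K (up (proj₂ (descending gap′ l n)) ≤i)) }
    }

-- Embeddings, index reducts, and consequences of the array axioms

module _ {S : Set} {L : Signature S} {ℓ} {M N : Structure L ℓ} (h : Embedding M N) where

  private
    module M = Structure M
    module N = Structure N
    module h = Embedding h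

  mutual
    eval-embedding : ∀ {Γ s} (ρ : All M.Carrier Γ) (t : Term L Γ s) →
                     h.to (eval M ρ t) ≡ eval N (All.map h.to ρ) t
    eval-embedding ρ (var v)    = sym (All.lookup-map ρ v)
    eval-embedding ρ (app f ts) =
      trans (h.to-fun f _) (cong N.⟦ f ⟧ᶠ (evals-embedding ρ ts))

    evals-embedding : ∀ {Γ Δ} (ρ : All M.Carrier Γ) (ts : All (Term L Γ) Δ) →
                      All.map h.to (evals M ρ ts) ≡ evals N (All.map h.to ρ) ts
    evals-embedding ρ []       = refl
    evals-embedding ρ (t ∷ ts) = cong₂ _∷_ (eval-embedding ρ t) (evals-embedding ρ ts)

  holds-embedding : ∀ {Γ} (ρ : All M.Carrier Γ) (φ : QFFormula L Γ) →
                    Holds M ρ φ ⇔ Holds N (All.map h.to ρ) φ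
  holds-embedding ρ falsum = mk⇔ (λ ()) (λ ())
  holds-embedding ρ (t ≐ u) = mk⇔
    (λ eq → trans (sym (eval-embedding ρ t)) (trans (cong h.to eq) (eval-embedding ρ u)))
    (λ eq → h.injective (trans (eval-embedding ρ t) (trans eq (sym (eval-embedding ρ u)))))
  holds-embedding ρ (rel R ts) = mk⇔
    (subst N.⟦ R ⟧ʳ (evals-embedding ρ ts) ∘ Equivalence.to (h.to-rel R _))
    (Equivalence.from (h.to-rel R _) ∘ subst N.⟦ R ⟧ʳ (sym (evals-embedding ρ ts)))
  holds-embedding ρ (φ ∧ ψ) = holds-embedding ρ φ ×-⇔ holds-embedding ρ ψ
  holds-embedding ρ (φ ∨ ψ) = holds-embedding ρ φ ⊎-⇔ holds-embedding ρ ψ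
  holds-embedding ρ (φ ⇒ ψ) = →-cong-⇔ (holds-embedding ρ φ) (holds-embedding ρ ψ)

embedding-∘ : ∀ {S : Set} {L : Signature S} {ℓ} {M N P : Structure L ℓ} →
              Embedding N P → Embedding M N → Embedding M P
embedding-∘ {P = P} g f = record
  { to        = g.to ∘ f.to
  ; injective = f.injective ∘ g.injective
  ; to-fun    = λ F xs → trans (cong g.to (f.to-fun F xs))
                  (trans (g.to-fun F _) (cong (Structure.⟦_⟧ᶠ P F) (All.map-∘ xs)))
  ; to-rel    = λ R xs → mk⇔
      (subst (Structure.⟦_⟧ʳ P R) (All.map-∘ xs) ∘ Equivalence.to (g.to-rel R _) ∘ Equivalence.to (f.to-rel R xs))
      (Equivalence.from (f.to-rel R xs) ∘ Equivalence.from (g.to-rel R _) ∘ subst (Structure.⟦_⟧ʳ P R) (sym (All.map-∘ xs)))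
  }
  where
  module g = Embedding g
  module f = Embedding f

module Reduct {ℓ} (T : IndexTheory ℓ) where

  private module T = IndexTheory T

  module _ (P : Sort → Set ℓ) where

    indexed : {Δ : List Unit} → All (λ _ → P INDEX) Δ → All P (indices T Δ)
    indexed = All.map⁺ {P = P}

    unindexed : {Δ : List Unit} → All P (indices T Δ) → All (λ _ → P INDEX) Δ
    unindexed = All.map⁻ {P = P}

    unindexed-indexed : {Δ : List Unit} (xs : All (λ _ → P INDEX) Δ) → unindexed (indexed xs) ≡ xs
    unindexed-indexed []       = refl
    unindexed-indexed (x ∷ xs) = cong (x ∷_) (unindexed-indexed xs)

    indexed-unindexed : {Δ : List Unit} (xs : All P (indices T Δ)) → indexed (unindexed xs) ≡ xs
    indexed-unindexed {[]}    []       = refl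
    indexed-unindexed {_ ∷ _} (x ∷ xs) = cong (x ∷_) (indexed-unindexed xs)

    lookup-indexed : {Γ : List Unit} (ρ : All (λ _ → P INDEX) Γ) (v : tt ∈ Γ) →
                     All.lookup (indexed ρ) (∈-map⁺ (λ _ → INDEX) v) ≡ All.lookup ρ v
    lookup-indexed (x ∷ ρ) (here refl) = refl
    lookup-indexed (x ∷ ρ) (there v)   = lookup-indexed ρ v

  module _ {P Q : Sort → Set ℓ} (g : ∀ {s} → P s → Q s) where

    map-indexed : {Δ : List Unit} (xs : All (λ _ → P INDEX) Δ) →
                  All.map g (indexed P xs) ≡ indexed Q (All.map (λ {_} → g {INDEX}) xs)
    map-indexed []       = refl
    map-indexed (x ∷ xs) = cong (g x ∷_) (map-indexed xs)

    map-unindexed : {Δ : List Unit} (xs : All P (indices T Δ)) →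
                    unindexed Q (All.map g xs) ≡ All.map (λ {_} → g {INDEX}) (unindexed P xs)
    map-unindexed {[]}    []       = refl
    map-unindexed {_ ∷ _} (x ∷ xs) = cong (g x ∷_) (map-unindexed xs)

  module _ (M : Structure (arrayLanguage T) ℓ) where

    private module M = Structure M

    reduct : Structure T.language ℓ
    reduct = record
      { Carrier = λ _ → M.Carrier INDEX
      ; ⟦_⟧ᶠ    = λ f xs → M.⟦ index f ⟧ᶠ (indexed M.Carrier xs)
      ; ⟦_⟧ʳ    = λ R xs → M.⟦ index R ⟧ʳ (indexed M.Carrier xs)
      }

    mutual
      eval-reduct : ∀ {Γ s} (ρ : All (Carrier reduct) Γ) (t : Term T.language Γ s) →
                    eval M (indexed M.Carrier ρ) (⌈_⌉ᵗ T t) ≡ eval reduct ρ t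
      eval-reduct ρ (var v)    = lookup-indexed M.Carrier ρ v
      eval-reduct ρ (app f ts) = cong M.⟦ index f ⟧ᶠ (evals-reduct ρ ts)

      evals-reduct : ∀ {Γ Δ} (ρ : All (Carrier reduct) Γ) (ts : All (Term T.language Γ) Δ) →
                     evals M (indexed M.Carrier ρ) (⌈_⌉ᵗˢ T ts) ≡ indexed M.Carrier (evals reduct ρ ts)
      evals-reduct ρ []       = refl
      evals-reduct ρ (t ∷ ts) = cong₂ _∷_ (eval-reduct ρ t) (evals-reduct ρ ts)

    holds-reduct : ∀ {Γ} (ρ : All (Carrier reduct) Γ) (φ : QFFormula T.language Γ) →
                   Holds M (indexed M.Carrier ρ) (⌈_⌉ᶠ T φ) ⇔ Holds reduct ρ φ
    holds-reduct ρ falsum = mk⇔ (λ ()) (λ ())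
    holds-reduct ρ (t ≐ u) = mk⇔
      (λ eq → trans (sym (eval-reduct ρ t)) (trans eq (eval-reduct ρ u)))
      (λ eq → trans (eval-reduct ρ t) (trans eq (sym (eval-reduct ρ u))))
    holds-reduct ρ (rel R ts) = mk⇔ (subst M.⟦ index R ⟧ʳ (evals-reduct ρ ts))
                                    (subst M.⟦ index R ⟧ʳ (sym (evals-reduct ρ ts)))
    holds-reduct ρ (φ ∧ ψ) = holds-reduct ρ φ ×-⇔ holds-reduct ρ ψ
    holds-reduct ρ (φ ∨ ψ) = holds-reduct ρ φ ⊎-⇔ holds-reduct ρ ψ
    holds-reduct ρ (φ ⇒ ψ) = →-cong-⇔ (holds-reduct ρ φ) (holds-reduct ρ ψ)

    reduct-model : M ⊨ CARDC T → reduct ⊨ T.axioms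
    reduct-model M-model = satisfying λ { {universal Γ φ} σ∈T ρ →
      Equivalence.to (holds-reduct ρ φ) (satisfies M-model (card (index σ∈T)) (indexed M.Carrier ρ)) }

  reduct-embedding : ∀ {M N : Structure (arrayLanguage T) ℓ} →
                     Embedding M N → Embedding (reduct M) (reduct N)
  reduct-embedding {M} {N} h = record
    { to        = h.to
    ; injective = h.injective
    ; to-fun    = λ f xs → trans (h.to-fun (index f) _)
                    (cong N.⟦ index f ⟧ᶠ (map-indexed h.to xs))
    ; to-rel    = λ R xs → mk⇔
        (subst N.⟦ index R ⟧ʳ (map-indexed h.to xs) ∘ Equivalence.to (h.to-rel (index R) _))
        (Equivalence.from (h.to-rel (index R) _) ∘ subst N.⟦ index R ⟧ʳ (sym (map-indexed h.to xs)))
    }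
    where
    module h = Embedding h
    module N = Structure N

module ArrayModel (em : EM) {ℓ} (T : IndexTheory ℓ)
                  (M : Structure (arrayLanguage T) ℓ) (model : M ⊨ CARDC T) where

  private module T = IndexTheory T
  open Truth em
  open Structure M using (⟦_⟧ᶠ)
  open Reduct T

  index-model : reduct M ⊨ T.axioms
  index-model = reduct-model M model

  open IndexModel em T (reduct M) index-model public

  private
    axiom : IsModel M (CARDC T)
    axiom = satisfies model

  Array Elem : Set ℓ
  Array = Carrier M ARRAY
  Elem  = Carrier M ELEM

  rd : Array → Index → Elem
  rd y i = ⟦ rdˢ ⟧ᶠ (y ∷ i ∷ [])

  wr : Array → Index → Elem → Array
  wr y i e = ⟦ wrˢ ⟧ᶠ (y ∷ i ∷ e ∷ [])

  diff : Array → Array → Index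
  diff x y = ⟦ diffˢ ⟧ᶠ (x ∷ y ∷ [])

  len : Array → Index
  len y = ⟦ lenˢ ⟧ᶠ (y ∷ [])

  Const : Index → Array
  Const i = ⟦ constˢ ⟧ᶠ (i ∷ [])

  undef el : Elem
  undef = ⟦ ⊥ˢ ⟧ᶠ []
  el    = ⟦ elˢ ⟧ᶠ []

  0# : Index
  0# = ⟦ index T.zeroᵢ ⟧ᶠ []

  InRange : Index → Index → Set ℓ
  InRange l i = 0# ≤ i × i ≤ l

  wr-len : ∀ y i e → len (wr y i e) ≡ len y
  wr-len y i e = axiom (card len-wr) (y ∷ i ∷ e ∷ [])

  wr-undef : ∀ y i → wr y i undef ≡ y
  wr-undef y i = axiom (card wr-⊥) (y ∷ i ∷ [])

  rd-wr-same : ∀ {y i e} → e ≢ undef → InRange (len y) i → rd (wr y i e) i ≡ e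
  rd-wr-same {y} {i} {e} e≢ r =
    axiom (card rd-wr-≡) (y ∷ i ∷ e ∷ []) ((λ eq → contradiction eq e≢) , r)

  rd-wr-other : ∀ {y i j e} → i ≢ j → rd (wr y i e) j ≡ rd y j
  rd-wr-other {y} {i} {j} {e} i≢j =
    axiom (card rd-wr-≢) (y ∷ i ∷ j ∷ e ∷ []) λ eq → contradiction eq i≢j

  rd-inside : ∀ {y i} → InRange (len y) i → rd y i ≢ undef
  rd-inside {y} {i} r eq = ⊥-elim (proj₂ (axiom (card rd-≢⊥) (y ∷ i ∷ [])) r eq)

  rd-outside : ∀ {y i} → ¬ InRange (len y) i → rd y i ≡ undef
  rd-outside {y} {i} ¬r = stable λ neq →
    ¬r (proj₁ (axiom (card rd-≢⊥) (y ∷ i ∷ [])) λ eq → contradiction eq neq)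

  rd-defined : ∀ {y i} → rd y i ≢ undef → InRange (len y) i
  rd-defined neq = stable λ ¬r → neq (rd-outside ¬r)

  0≤len : ∀ y → 0# ≤ len y
  0≤len y = axiom (card len-≥0) (y ∷ [])

  diff-self : ∀ y → diff y y ≡ 0#
  diff-self y = axiom (card diff-≡) (y ∷ [])

  diff-separates : ∀ {x y} → x ≢ y → rd x (diff x y) ≢ rd y (diff x y)
  diff-separates {x} {y} x≢y eq =
    ⊥-elim (axiom (card diff-≢) (x ∷ y ∷ []) (λ x≡y → contradiction x≡y x≢y) eq)

  diff-maximal : ∀ {x y i} → diff x y < i → rd x i ≡ rd y i
  diff-maximal {x} {y} {i} d<i = axiom (card diff-max) (x ∷ y ∷ i ∷ [])
    (<⇒≤ d<i , λ d≡i → contradiction d≡i (<⇒≢ d<i))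

  undef≢el : undef ≢ el
  undef≢el eq = ⊥-elim (axiom (card ⊥≢el) [] eq)

  Const-len-max : ∀ i → len (Const i) ≡ ⟦ index T.max ⟧ᶠ (i ∷ 0# ∷ [])
  Const-len-max i = axiom len-Const (i ∷ [])

  Const-len : ∀ {i} → 0# ≤ i → len (Const i) ≡ i
  Const-len {i} 0≤i = trans (Const-len-max i)
    (proj₂ (isMax i 0#) 0≤i)

  Const-rd : ∀ {i j} → InRange (len (Const i)) j → rd (Const i) j ≡ el
  Const-rd {i} {j} r = axiom rd-Const (i ∷ j ∷ []) r

  array-ext : ∀ {x y} → (∀ i → rd x i ≡ rd y i) → x ≡ y
  array-ext h = stable λ x≢y → diff-separates x≢y (h _)

  -- If the value written is ⊥, the write has no effect, but y is undefined at i too.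
  rd-wr-rd : ∀ {x y i} → len x ≡ len y → rd (wr y i (rd x i)) i ≡ rd x i
  rd-wr-rd {x} {y} {i} eq with em {P = rd x i ≡ undef}
  ... | no  neq = rd-wr-same neq (subst (λ l → InRange l i) eq (rd-defined neq))
  ... | yes x≡⊥ = trans (cong (λ e → rd (wr y i e) i) x≡⊥) (trans (cong (λ z → rd z i) (wr-undef y i))
        (trans (rd-outside λ r → rd-inside (subst (λ l → InRange l i) (sym eq) r) x≡⊥) (sym x≡⊥)))

  -- If `diff x y` is below `len x`, then `y` is defined at `len x` too, so `len x ≤ len y`; now
  -- `diff x y` is also below `len y`, and the converse inequality follows.
  len≢⇒len≤diff : ∀ {x y} → len x ≢ len y → len x ≤ diff x y × len y ≤ diff x y
  len≢⇒len≤diff {x} {y} len≢ =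
    (≮⇒≥ λ d<x → len≢ (antisym (x≤y d<x) (y≤x (<-≤-trans d<x (x≤y d<x))))) ,
    (≮⇒≥ λ d<y → len≢ (antisym (x≤y (<-≤-trans d<y (y≤x d<y))) (y≤x d<y)))
    where
    x≤y : diff x y < len x → len x ≤ len y
    x≤y d<x = proj₂ (rd-defined {y} λ eq →
      rd-inside (0≤len x , ≤-refl) (trans (diff-maximal d<x) eq))
    y≤x : diff x y < len y → len y ≤ len x
    y≤x d<y = proj₂ (rd-defined {x} λ eq →
      rd-inside (0≤len y , ≤-refl) (trans (sym (diff-maximal d<y)) eq))

  rd≢⇒inRange : ∀ {x y i} → len x ≡ len y → rd x i ≢ rd y i → InRange (len y) i
  rd≢⇒inRange {i = i} eq neq = stable λ ¬r →
    neq (trans (rd-outside (subst (λ l → ¬ InRange l i) (sym eq) ¬r)) (sym (rd-outside ¬r)))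

  Const-unique : ∀ {i j} → len (Const i) ≡ len (Const j) → Const i ≡ Const j
  Const-unique {i} {j} eq = array-ext λ k → stable λ neq →
    let r = rd≢⇒inRange eq neq in
    neq (trans (Const-rd (subst (λ l → InRange l k) (sym eq) r)) (sym (Const-rd r)))

module ArrayEmbedding (em : EM) {ℓ} (T : IndexTheory ℓ) {M N : Structure (arrayLanguage T) ℓ}
                      (M-model : M ⊨ CARDC T) (N-model : N ⊨ CARDC T)
                      (h : Embedding M N) where

  private
    module T = IndexTheory T
    module M = ArrayModel em T M M-model
    module N = ArrayModel em T N N-model
    module h = Embedding h

  ≤-from : ∀ {i j} → h.to i N.≤ h.to j → i M.≤ j
  ≤-from = Equivalence.from (h.to-rel (index T.leq) _)

  to-0# : h.to M.0# ≡ N.0#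
  to-0# = h.to-fun (index T.zeroᵢ) []

  to-rd : ∀ {y i} → h.to (M.rd y i) ≡ N.rd (h.to y) (h.to i)
  to-rd = h.to-fun rdˢ _

  to-wr : ∀ {y i e} → h.to (M.wr y i e) ≡ N.wr (h.to y) (h.to i) (h.to e)
  to-wr = h.to-fun wrˢ _

  to-diff : ∀ {x y} → h.to (M.diff x y) ≡ N.diff (h.to x) (h.to y)
  to-diff = h.to-fun diffˢ _

  to-len : ∀ {y} → h.to (M.len y) ≡ N.len (h.to y)
  to-len = h.to-fun lenˢ _

  to-Const : ∀ {i} → h.to (M.Const i) ≡ N.Const (h.to i)
  to-Const = h.to-fun constˢ _

  to-undef : h.to M.undef ≡ N.undef
  to-undef = h.to-fun ⊥ˢ []

  to-el : h.to M.el ≡ N.el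
  to-el = h.to-fun elˢ []

-- Largest differences of functions on a total order

module Difference (em : EM) {ℓ} {J E : Set ℓ} {_≤_ : J → J → Set ℓ}
                  (isTotalOrder : IsTotalOrder _≡_ _≤_) where

  open Truth em
  open TotalOrder em isTotalOrder

  Top : (J → Set ℓ) → Set ℓ
  Top P = ∃[ m ] (P m × (∀ x → P x → x ≤ m))

  Topped : (J → Set ℓ) → Set ℓ
  Topped P = ∃ P → Top P

  Differ : List J → (J → E) → (J → E) → J → Set ℓ
  Differ F g h x = g x ≢ h x × x ∉ F

  -- Requiring a top outside every finite set makes this stable under writes.
  Good : (J → E) → (J → E) → Set ℓ
  Good g h = ∀ F → Topped (Differ F g h)

  topped-cong : ∀ {P Q} → (∀ {x} → P x → Q x) → (∀ {x} → Q x → P x) → Topped P → Topped Q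
  topped-cong f g topped (x , q) with topped (x , g q)
  ... | m , p , max = m , f p , λ y → max y ∘ g

  -- One more point cannot destroy a largest element: the larger of `y` and the old top serves.
  -- Hence finite sets of exceptions can be put back.
  topped-insert : ∀ {P} y → Topped (λ x → P x × x ≢ y) → Topped P
  topped-insert {P} y topped (x , p) with em {P = P y}
  ... | no ¬py = topped-cong proj₁ (λ pz → pz , λ { refl → ¬py pz }) topped (x , p)
  ... | yes py with em {P = ∃[ z ] (P z × z ≢ y)}
  ...   | no ¬z = y , py , λ z pz → stable λ z≰y → ¬z (z , pz , λ { refl → z≰y ≤-refl })
  ...   | yes z with topped z
  ...     | m , (pm , _) , max with total m y
  ...       | inj₁ m≤y = y , py , λ w pw → stable λ w≰y →
                w≰y (≤-trans (max w (pw , λ { refl → w≰y ≤-refl })) m≤y)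
  ...       | inj₂ y≤m = m , pm , λ w pw → stable λ w≰m →
                w≰m (max w (pw , λ { refl → w≰m y≤m }))

  topped-finite : ∀ {P} L → Topped (λ x → P x × x ∉ L) → Topped P
  topped-finite []      = topped-cong proj₁ (λ p → p , λ ())
  topped-finite (y ∷ L) topped = topped-insert y (topped-finite L (topped-cong
    (λ { (p , x∉) → (p , λ { refl → x∉ (here refl) }) , x∉ ∘ there })
    (λ { ((p , x≢y) , x∉L) → p , λ { (here x≡y) → x≢y x≡y ; (there x∈L) → x∉L x∈L } })
    topped))

  good-sym : ∀ {g h} → Good g h → Good h g
  good-sym good F = topped-cong (λ { (neq , x∉F) → neq ∘ sym , x∉F })
                                (λ { (neq , x∉F) → neq ∘ sym , x∉F }) (good F)

  good-modify : ∀ {g g′ h} L → (∀ j → j ∉ L → g j ≡ g′ j) → Good g h → Good g′ h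
  good-modify L g≡g′ good F = topped-finite L (topped-cong
    (λ { {x} (neq , x∉) → let x∉L = x∉ ∘ ∈-++⁺ˡ in
         ((λ eq → neq (trans (g≡g′ x x∉L) eq)) , x∉ ∘ ∈-++⁺ʳ L) , x∉L })
    (λ { {x} ((neq , x∉F) , x∉L) →
         (λ eq → neq (trans (sym (g≡g′ x x∉L)) eq)) , [ x∉L , x∉F ]′ ∘ ∈-++⁻ L })
    (good (L ++ F)))

  good-cong : ∀ {g g′ h h′} → (∀ j → g j ≡ g′ j) → (∀ j → h j ≡ h′ j) → Good g h → Good g′ h′
  good-cong g≡g′ h≡h′ good = good-sym (good-modify [] (λ j _ → h≡h′ j)
    (good-sym (good-modify [] (λ j _ → g≡g′ j) good)))

  -- Above `j` and outside `F₁`, `g` differs from `h` exactly where `p` does, so `Good p h` gives a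
  -- top there. Differences below `j` do not matter once there is one at `x`, above `j`.
  top-above : ∀ {p g h j F F₁ x} → (∀ k → j ≤ k → k ∉ F₁ → p k ≡ g k) → Good p h →
              j ≤ x → Differ F g h x → Top (Differ F g h)
  top-above {p} {g} {h} {j} {F} {F₁} {x} p≡g good j≤x dx
    with topped-finite {λ y → Differ F g h y × j ≤ y} F₁ topped (x , dx , j≤x)
    where
    to-p : ∀ {y} → (Differ F g h y × j ≤ y) × y ∉ F₁ → Differ (F ++ F₁) p h y
    to-p {y} (((neq , y∉F) , j≤y) , y∉F₁) =
      (λ eq → neq (trans (sym (p≡g y j≤y y∉F₁)) eq)) , [ y∉F , y∉F₁ ]′ ∘ ∈-++⁻ F
    topped : Topped (λ y → (Differ F g h y × j ≤ y) × y ∉ F₁)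
    topped (y , dy) with good (F ++ F₁) (y , to-p dy)
    ... | m , (neq , m∉) , max =
      let j≤m = ≤-trans (proj₂ (proj₁ dy)) (max y (to-p dy)) in
      m , ((((λ eq → neq (trans (p≡g m j≤m (m∉ ∘ ∈-++⁺ʳ F)) eq)) , m∉ ∘ ∈-++⁺ˡ) , j≤m)
          , m∉ ∘ ∈-++⁺ʳ F)
        , λ z → max z ∘ to-p
  ... | m , (dm , j≤m) , max = m , dm , λ z dz →
        [ (λ j≤z → max z (dz , j≤z)) , (λ z≤j → ≤-trans z≤j j≤m) ]′ (total j z)

-- Extending the arrays of one side to `J`

module Side (em : EM) (ext : Ext) {ℓ} (T : IndexTheory ℓ)
            {I : Structure (IndexTheory.language T) ℓ}
            (I-model : I ⊨ IndexTheory.axioms T)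
            (filling : CutFilling em T I I-model)
            {A M : Structure (arrayLanguage T) ℓ}
            (A-model : A ⊨ CARDC T) (M-model : M ⊨ CARDC T)
            (ι : Embedding A M) (σ : Embedding (Reduct.reduct T M) I)
            where

  private module T = IndexTheory T
  open CutFilling filling

  module A = ArrayModel em T A A-model
  module M = ArrayModel em T M M-model
  module I = IndexModel em T I I-model
  module J = IndexModel em T J J-model
  module ι = ArrayEmbedding em T A-model M-model ι
  module σ = Embedding σ
  module ε = Embedding ε

  0J : J.Index
  0J = Structure.⟦_⟧ᶠ J T.zeroᵢ []

  Range : J.Index → J.Index → Set ℓ
  Range l j = 0J J.≤ j × j J.≤ l

  ν : M.Index → J.Index
  ν i = ε.to (σ.to i)

  α : A.Index → J.Index
  α i = ν (to ι i)

  ε-≤⁺ : ∀ {i j} → i I.≤ j → ε.to i J.≤ ε.to j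
  ε-≤⁺ = Equivalence.to (ε.to-rel T.leq _)

  ε-≤⁻ : ∀ {i j} → ε.to i J.≤ ε.to j → i I.≤ j
  ε-≤⁻ = Equivalence.from (ε.to-rel T.leq _)

  ν-≤⁺ : ∀ {i j} → i M.≤ j → ν i J.≤ ν j
  ν-≤⁺ = ε-≤⁺ ∘ Equivalence.to (σ.to-rel T.leq _)

  ν-≤⁻ : ∀ {i j} → ν i J.≤ ν j → i M.≤ j
  ν-≤⁻ = Equivalence.from (σ.to-rel T.leq _) ∘ ε-≤⁻

  ν-injective : ∀ {i j} → ν i ≡ ν j → i ≡ j
  ν-injective = σ.injective ∘ ε.injective

  ν-0# : ν M.0# ≡ 0J
  ν-0# = trans (cong ε.to (σ.to-fun T.zeroᵢ [])) (ε.to-fun T.zeroᵢ [])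

  α-injective : ∀ {i j} → α i ≡ α j → i ≡ j
  α-injective = Embedding.injective ι ∘ ν-injective

  size : M.Array → J.Index
  size b = ν (M.len b)

  sizeA : A.Array → J.Index
  sizeA a = α (A.len a)

  size-ι : ∀ {a} → size (to ι a) ≡ sizeA a
  size-ι = cong ν (sym ι.to-len)

  Own : J.Index → Set ℓ
  Own j = ∃[ i ] j ≡ ν i

  range-ν⁺ : ∀ {l i} → M.InRange l i → Range (ν l) (ν i)
  range-ν⁺ {i = i} (p , q) = subst (J._≤ ν i) ν-0# (ν-≤⁺ p) , ν-≤⁺ q

  range-ν⁻ : ∀ {l i} → Range (ν l) (ν i) → M.InRange l i
  range-ν⁻ {i = i} (p , q) = ν-≤⁻ (subst (J._≤ ν i) (sym ν-0#) p) , ν-≤⁻ q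

  rd-ι-wr : ∀ {a k e i} → ν i ≢ α k → M.rd (to ι (A.wr a k e)) i ≡ M.rd (to ι a) i
  rd-ι-wr {i = i} i≢k = trans (cong (λ y → M.rd y i) ι.to-wr)
    (M.rd-wr-other λ eq → i≢k (cong ν (sym eq)))

  rd-ι-diff : ∀ {a a′ i} → α (A.diff a a′) J.< ν i → M.rd (to ι a) i ≡ M.rd (to ι a′) i
  rd-ι-diff {i = i} d<i = M.diff-maximal (subst (M._< i) ι.to-diff (d<i ∘ ν-≤⁺))

  rd-ι-inside : ∀ {a i} → Range (sizeA a) (ν i) → M.rd (to ι a) i ≢ M.undef
  rd-ι-inside {i = i} r = M.rd-inside (range-ν⁻ (subst (λ l → Range l (ν i)) (sym size-ι) r))

  rd-ι-outside : ∀ {a i} → ¬ Range (sizeA a) (ν i) → M.rd (to ι a) i ≡ M.undef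
  rd-ι-outside {i = i} ¬r = M.rd-outside λ r → ¬r (subst (λ l → Range l (ν i)) size-ι (range-ν⁺ r))

  rd-ι-Const : ∀ {k i} → Range (sizeA (A.Const k)) (ν i) → M.rd (to ι (A.Const k)) i ≡ M.el
  rd-ι-Const {k} {i} r = trans (cong (λ y → M.rd y i) ι.to-Const) (M.Const-rd
    (range-ν⁻ (subst (λ l → Range l (ν i)) (trans (sym size-ι) (cong size ι.to-Const)) r)))

  -- fa extends the arrays of A compatibly with both sides; star is private to
  -- the side of M.
  record ElementData : Set (lsuc ℓ) where
    field
      E           : Set ℓ
      ⊥E elE star : E
      elE≢⊥       : elE ≢ ⊥E
      star≢⊥      : star ≢ ⊥E
      inE         : M.Elem → E
      inE-inj     : ∀ {e e′} → inE e ≡ inE e′ → e ≡ e′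
      inE-⊥       : inE M.undef ≡ ⊥E
      inE-el      : inE M.el ≡ elE
      fa          : A.Array → J.Index → E
      fa-own      : ∀ {a i} → fa a (ν i) ≡ inE (M.rd (to ι a) i)
      fa-wr       : ∀ {a i e j} → j ≢ α i → fa (A.wr a i e) j ≡ fa a j
      fa-diff     : ∀ {a a′ j} → A.len a ≡ A.len a′ → α (A.diff a a′) J.< j → fa a j ≡ fa a′ j
      fa-inside   : ∀ {a j} → Range (sizeA a) j → fa a j ≢ ⊥E
      fa-outside  : ∀ {a j} → ¬ Range (sizeA a) j → fa a j ≡ ⊥E
      fa-Const    : ∀ {i j} → Range (sizeA (A.Const i)) j → fa (A.Const i) j ≡ elE

  module Extend (elements : ElementData) where

    open ElementData elements
    open Truth em
    open Difference em {E = E} J.isTotalOrder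

    -- Closeness is up to finitely many indices because the extension to J has
    -- to commute with writes.
    Close : J.Index → A.Array → M.Array → Set ℓ
    Close j a b = M.len (to ι a) ≡ M.len b ×
      ∃[ F ] (∀ i → j J.≤ ν i → ν i ∉ F → M.rd (to ι a) i ≡ M.rd b i)

    Similar : J.Index → M.Array → M.Array → Set ℓ
    Similar j b b′ = M.len b ≡ M.len b′ ×
      ∃[ F ] (∀ i → j J.≤ ν i → ν i ∉ F → M.rd b i ≡ M.rd b′ i)

    Near : M.Array → J.Index → Set ℓ
    Near b j = ∃[ a ] Close j a b

    -- Taken on `I`, which both sides share, so that the sets of two arrays from different sides can
    -- be equal and then determine the same cut.
    K : M.Array → I.Index → Bool
    K b i = char (Near b (ε.to i))

    -- `CutFilling` says something about `cut` only at a gap; this also keeps stars away from arrays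
    -- that are near nowhere.
    Starred : M.Array → J.Index → Set ℓ
    Starred b j = I.Gap (K b) × ∃[ n ] j ≡ cut (K b) n

    close-similar : ∀ {j a b b′} → Close j a b → Similar j b b′ → Close j a b′
    close-similar (len≡ , F , agree) (len≡′ , F′ , agree′) = trans len≡ len≡′ , F ++ F′ , λ i j≤i i∉ →
      trans (agree i j≤i (i∉ ∘ ∈-++⁺ˡ)) (agree′ i j≤i (i∉ ∘ ∈-++⁺ʳ F))

    similar-sym : ∀ {j b b′} → Similar j b b′ → Similar j b′ b
    similar-sym (len≡ , F , agree) = sym len≡ , F , λ i j≤i i∉ → sym (agree i j≤i i∉)

    close-mono : ∀ {j k a b} → j J.≤ k → Close j a b → Close k a b
    close-mono j≤k (len≡ , F , agree) = len≡ , F , λ i k≤i → agree i (J.≤-trans j≤k k≤i)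

    similar-mono : ∀ {j k b b′} → j J.≤ k → Similar j b b′ → Similar k b b′
    similar-mono j≤k (len≡ , F , agree) = len≡ , F , λ i k≤i → agree i (J.≤-trans j≤k k≤i)

    near-mono : ∀ {j k b} → j J.≤ k → Near b j → Near b k
    near-mono j≤k (a , close) = a , close-mono j≤k close

    -- Exceptions at indices of A are removed by writing the value of `a` into `a′`, which leaves
    -- `fa` at `j` unchanged. Without exceptions, `diff a a′` is below `j` or the arrays are equal.
    fa-finite : ∀ {j} → (∀ i → j ≢ α i) → ∀ F {a a′} → A.len a ≡ A.len a′ →
                (∀ i → j J.≤ α i → α i ∉ F → A.rd a i ≡ A.rd a′ i) → fa a j ≡ fa a′ j
    fa-finite {j} j∉A [] {a} {a′} len≡ agree with em {P = α (A.diff a a′) J.< j}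
    ... | yes d<j = fa-diff len≡ d<j
    ... | no  d≮j = cong (λ x → fa x j) (stable λ a≢a′ →
          A.diff-separates a≢a′ (agree _ (J.≮⇒≥ d≮j) λ ()))
    fa-finite {j} j∉A (x ∷ F) {a} {a′} len≡ agree with em {P = ∃[ i ] x ≡ α i}
    ... | no x∉A = fa-finite j∉A F len≡ λ i j≤i i∉F → agree i j≤i
          λ { (here i≡x) → x∉A (i , sym i≡x) ; (there i∈F) → i∉F i∈F }
    ... | yes (i , refl) =
          trans (fa-finite j∉A F (trans len≡ (sym (A.wr-len a′ i _))) agree′) (fa-wr (j∉A i))
      where
      agree′ : ∀ k → j J.≤ α k → α k ∉ F → A.rd a k ≡ A.rd (A.wr a′ i (A.rd a i)) k
      agree′ k j≤k k∉F with em {P = i ≡ k}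
      ... | yes refl = sym (A.rd-wr-rd len≡)
      ... | no  i≢k  = trans (agree k j≤k λ { (here k≡i) → i≢k (sym (α-injective k≡i))
                                            ; (there k∈F) → k∉F k∈F })
                             (sym (A.rd-wr-other i≢k))

    fa-close : ∀ {j a a′ b} → ¬ Own j → Close j a b → Close j a′ b → fa a j ≡ fa a′ j
    fa-close {j} {a} {a′} ¬own (len≡ , F , agree) (len≡′ , F′ , agree′) =
      fa-finite (λ i j≡i → ¬own (_ , j≡i)) (F ++ F′)
        (Embedding.injective ι (trans ι.to-len (trans len≡ (trans (sym len≡′) (sym ι.to-len)))))
        λ i j≤i i∉ → Embedding.injective ι (trans ι.to-rd (trans (agree _ j≤i (i∉ ∘ ∈-++⁺ˡ))
          (trans (sym (agree′ _ j≤i (i∉ ∘ ∈-++⁺ʳ F))) (sym ι.to-rd))))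

    abstract

      -- The array `a` found by `em` is arbitrary; `fa-close` makes the value independent of it.
      f : M.Array → J.Index → E
      f b j with em {P = Own j}
      ... | yes (i , _) = inE (M.rd b i)
      ... | no _ with em {P = Near b j}
      ...   | yes (a , _) = fa a j
      ...   | no _ with em {P = Range (size b) j}
      ...     | no  _ = ⊥E
      ...     | yes _ with em {P = Starred b j}
      ...       | yes _ = star
      ...       | no  _ = elE

      f-own : ∀ {b i} → f b (ν i) ≡ inE (M.rd b i)
      f-own {b} {i} with em {P = Own (ν i)}
      ... | yes (k , eq) = cong (inE ∘ M.rd b) (sym (ν-injective eq))
      ... | no ¬own      = contradiction (i , refl) ¬own

      f-near : ∀ {b a j} → ¬ Own j → Close j a b → f b j ≡ fa a j
      f-near {b} {a} {j} ¬own close with em {P = Own j}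
      ... | yes own = contradiction own ¬own
      ... | no _ with em {P = Near b j}
      ...   | yes (_ , close′) = fa-close ¬own close′ close
      ...   | no ¬near         = contradiction (a , close) ¬near

      f-out : ∀ {b j} → ¬ Own j → ¬ Near b j → ¬ Range (size b) j → f b j ≡ ⊥E
      f-out {b} {j} ¬own ¬near ¬range with em {P = Own j}
      ... | yes own = contradiction own ¬own
      ... | no _ with em {P = Near b j}
      ...   | yes near = contradiction near ¬near
      ...   | no _ with em {P = Range (size b) j}
      ...     | no  _     = refl
      ...     | yes range = contradiction range ¬range

      f-star : ∀ {b j} → ¬ Own j → ¬ Near b j → Range (size b) j → Starred b j → f b j ≡ star
      f-star {b} {j} ¬own ¬near range starred with em {P = Own j}
      ... | yes own = contradiction own ¬own
      ... | no _ with em {P = Near b j}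
      ...   | yes near = contradiction near ¬near
      ...   | no _ with em {P = Range (size b) j}
      ...     | no  ¬range = contradiction range ¬range
      ...     | yes _ with em {P = Starred b j}
      ...       | yes _        = refl
      ...       | no  ¬starred = contradiction starred ¬starred

      f-el : ∀ {b j} → ¬ Own j → ¬ Near b j → Range (size b) j → ¬ Starred b j → f b j ≡ elE
      f-el {b} {j} ¬own ¬near range ¬starred with em {P = Own j}
      ... | yes own = contradiction own ¬own
      ... | no _ with em {P = Near b j}
      ...   | yes near = contradiction near ¬near
      ...   | no _ with em {P = Range (size b) j}
      ...     | no  ¬range = contradiction range ¬range
      ...     | yes _ with em {P = Starred b j}
      ...       | yes starred = contradiction starred ¬starred
      ...       | no  _       = refl

    -- At a new index, the value depends only on the array from there upwards, up to finitely many
    -- places. Compatibility with `wr` and `diff` is deduced from this.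
    f-similar : ∀ {b b′ j} → ¬ Own j → Similar j b b′ → f b j ≡ f b′ j
    f-similar {b} {b′} {j} ¬own sim with em {P = Near b j}
    ... | yes (a , close) = trans (f-near ¬own close) (sym (f-near ¬own (close-similar close sim)))
    ... | no ¬near = by-cases
      where
      ¬near′ : ¬ Near b′ j
      ¬near′ (a , close) = ¬near (a , close-similar close (similar-sym sim))

      -- Nearness passes upwards and fails at `j`, so all of `K c` lies above `j`, where the
      -- similarity applies.
      K-⊆ : ∀ {c c′} → ¬ Near c j → Similar j c c′ → ∀ {i} → K c i ≡ true → K c′ i ≡ true
      K-⊆ ¬near-c sim-c {i} i∈K with char⁻ i∈K
      ... | a , close = char⁺ (a , close-similar close (similar-mono j≤i sim-c))
        where
        j≤i : j J.≤ ε.to i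
        j≤i = J.<⇒≤ λ i≤j → ¬near-c (a , close-mono i≤j close)

      K≡ : K b ≡ K b′
      K≡ = ext λ i → bool-cong (K-⊆ ¬near sim) (K-⊆ ¬near′ (similar-sym sim))

      size≡ : size b ≡ size b′
      size≡ = cong ν (proj₁ sim)

      by-cases : f b j ≡ f b′ j
      by-cases with em {P = Range (size b) j}
      ... | no ¬r = trans (f-out ¬own ¬near ¬r)
                      (sym (f-out ¬own ¬near′ (subst (λ l → ¬ Range l j) size≡ ¬r)))
      ... | yes r with em {P = Starred b j}
      ...   | yes s = trans (f-star ¬own ¬near r s)
                        (sym (f-star ¬own ¬near′ (subst (λ l → Range l j) size≡ r)
                          (subst (λ k → I.Gap k × ∃[ n ] j ≡ cut k n) K≡ s)))
      ...   | no ¬s = trans (f-el ¬own ¬near r ¬s)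
                        (sym (f-el ¬own ¬near′ (subst (λ l → Range l j) size≡ r)
                          (subst (λ k → ¬ (I.Gap k × ∃[ n ] j ≡ cut k n)) K≡ ¬s)))

    size-close : ∀ {a b j} → Close j a b → sizeA a ≡ size b
    size-close (len≡ , _) = trans (sym size-ι) (cong ν len≡)

    f-inside : ∀ {b j} → Range (size b) j → f b j ≢ ⊥E
    f-inside {b} {j} r eq with em {P = Own j}
    ... | yes (i , refl) = M.rd-inside (range-ν⁻ r) (inE-inj (trans (sym f-own) (trans eq (sym inE-⊥))))
    ... | no ¬own with em {P = Near b j}
    ...   | yes (a , close) = fa-inside (subst (λ l → Range l j) (sym (size-close close)) r)
                                (trans (sym (f-near ¬own close)) eq)
    ...   | no ¬near with em {P = Starred b j}
    ...     | yes s = star≢⊥ (trans (sym (f-star ¬own ¬near r s)) eq)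
    ...     | no ¬s = elE≢⊥ (trans (sym (f-el ¬own ¬near r ¬s)) eq)

    f-outside : ∀ {b j} → ¬ Range (size b) j → f b j ≡ ⊥E
    f-outside {b} {j} ¬r with em {P = Own j}
    ... | yes (i , refl) = trans f-own (trans (cong inE (M.rd-outside (¬r ∘ range-ν⁺))) inE-⊥)
    ... | no ¬own with em {P = Near b j}
    ...   | no ¬near = f-out ¬own ¬near ¬r
    ...   | yes (a , close) = trans (f-near ¬own close)
              (fa-outside (subst (λ l → ¬ Range l j) (sym (size-close close)) ¬r))

    -- At a new index, equal lengths give similarity without exceptions; if the lengths differ, `j`
    -- is beyond both.
    f-diff : ∀ {b b′ j} → ν (M.diff b b′) J.< j → f b j ≡ f b′ j
    f-diff {b} {b′} {j} d<j with em {P = Own j}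
    ... | yes (i , refl) = trans f-own (trans (cong inE (M.diff-maximal (d<j ∘ ν-≤⁺))) (sym f-own))
    ... | no ¬own with em {P = M.len b ≡ M.len b′}
    ...   | yes len≡ = f-similar ¬own (len≡ , [] , λ i j≤i _ →
              M.diff-maximal λ i≤d → d<j (J.≤-trans j≤i (ν-≤⁺ i≤d)))
    ...   | no  len≢ with M.len≢⇒len≤diff len≢
    ...     | b≤d , b′≤d =
              trans (f-outside λ { (_ , j≤b) → d<j (J.≤-trans j≤b (ν-≤⁺ b≤d)) })
                (sym (f-outside λ { (_ , j≤b′) → d<j (J.≤-trans j≤b′ (ν-≤⁺ b′≤d)) }))

    f-wr : ∀ {b i e j} → j ≢ ν i → f (M.wr b i e) j ≡ f b j
    f-wr {b} {i} {e} {j} j≢i with em {P = Own j}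
    ... | yes (k , refl) = trans f-own (trans (cong inE (M.rd-wr-other λ { refl → j≢i refl })) (sym f-own))
    ... | no ¬own = f-similar ¬own (M.wr-len b i e , ν i ∷ [] , λ k _ k∉ →
          M.rd-wr-other λ { refl → k∉ (here refl) })

    f-image : ∀ {a} j → f (to ι a) j ≡ fa a j
    f-image {a} j with em {P = Own j}
    ... | yes (i , refl) = trans f-own (sym fa-own)
    ... | no ¬own        = f-near ¬own (refl , [] , λ _ _ _ → refl)

    f-injective : ∀ {b b′} → (∀ j → f b j ≡ f b′ j) → b ≡ b′
    f-injective eq = M.array-ext λ i → inE-inj (trans (sym f-own) (trans (eq (ν i)) f-own))

    -- If some array of A has this length, the constant array itself comes from A. Otherwise the
    -- array is near nowhere, its `K` is empty, and no star interferes.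
    f-Const : ∀ {i j} → Range (size (M.Const i)) j → f (M.Const i) j ≡ elE
    f-Const {i} {j} r with em {P = ∃[ a ] M.len (to ι a) ≡ M.len (M.Const i)}
    ... | yes (a , len≡) =
          trans (cong (λ b → f b j) Const≡) (trans (f-image j) (fa-Const
            (subst (λ l → Range l j) (trans (cong size Const≡) size-ι) r)))
      where
      len-Const-len : A.len (A.Const (A.len a)) ≡ A.len a
      len-Const-len = A.Const-len (A.0≤len a)
      Const≡ : M.Const i ≡ to ι (A.Const (A.len a))
      Const≡ = trans (M.Const-unique (trans (sym len≡) (trans (sym ι.to-len)
        (trans (cong (to ι) (sym len-Const-len)) (trans ι.to-len (cong M.len ι.to-Const))))))
        (sym ι.to-Const)
    ... | no ¬a with em {P = Own j}
    ...   | yes (k , refl) = trans f-own (trans (cong inE (M.Const-rd (range-ν⁻ r))) inE-el)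
    ...   | no ¬own = f-el ¬own ¬near r λ { (((k , k∈K) , _) , _) → ¬near (char⁻ k∈K) }
      where
      ¬near : ∀ {k} → ¬ Near (M.Const i) k
      ¬near (a , len≡ , _) = ¬a (a , len≡)

    -- An index of M in `F` is discarded by writing the value of `b` into `b′` there; equal lengths
    -- ensure that this removes the difference. What remains is found by `diff`, so the top is an
    -- index of M.
    top-own : ∀ F {b b′} → M.len b ≡ M.len b′ → ∃ (Differ F (f b) (f b′)) →
              ∃[ m ] (Differ F (f b) (f b′) (ν m) × (∀ x → Differ F (f b) (f b′) x → x J.≤ ν m))
    top-own [] {b} {b′} len≡ (x , neq , _) =
      M.diff b b′
      , ((λ eq → M.diff-separates b≢b′ (inE-inj (trans (sym f-own) (trans eq f-own)))) , λ ())
      , λ { y (neq′ , _) → J.≮⇒≥ λ d<y → neq′ (f-diff d<y) }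
      where
      b≢b′ : b ≢ b′
      b≢b′ refl = neq refl
    top-own (y ∷ F) {b} {b′} len≡ (x , neq , x∉) with em {P = Own y}
    ... | no ¬own with top-own F len≡ (x , neq , x∉ ∘ there)
    ...   | m , (neq′ , m∉F) , max = m
            , (neq′ , λ { (here m≡y) → ¬own (m , sym m≡y) ; (there m∈F) → m∉F m∈F })
            , λ { z (neq″ , z∉) → max z (neq″ , z∉ ∘ there) }
    top-own (y ∷ F) {b} {b′} len≡ (x , neq , x∉) | yes (i , refl)
      with top-own F {b} {b″} (trans len≡ (sym (M.wr-len b′ i _))) (x , forward (neq , x∉))
      where
      b″ : M.Array
      b″ = M.wr b′ i (M.rd b i)
      forward : ∀ {z} → Differ (ν i ∷ F) (f b) (f b′) z → Differ F (f b) (f b″) z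
      forward (neq , z∉) =
        (λ eq → neq (trans eq (f-wr λ { refl → z∉ (here refl) }))) , z∉ ∘ there
    ...   | m , (neq′ , m∉F) , max = m
            , ((λ eq → neq′ (trans eq (sym (f-wr (m≢i ∘ ν-injective)))))
              , λ { (here m≡i) → m≢i (ν-injective m≡i) ; (there m∈F) → m∉F m∈F })
            , λ { z (neq″ , z∉) → max z
                ((λ eq → neq″ (trans eq (f-wr λ { refl → z∉ (here refl) }))) , z∉ ∘ there) }
      where
      m≢i : m ≢ i
      m≢i refl = neq′ (trans f-own (trans (cong inE (sym (M.rd-wr-rd len≡))) (sym f-own)))

    f-good : ∀ {b b′} → M.len b ≡ M.len b′ → Good (f b) (f b′)
    f-good len≡ F differ with top-own F len≡ differ
    ... | m , dm , max = ν m , dm , max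

    -- Take the largest difference outside `F`; it exists, or `a` would be close to `b` everywhere.
    -- Once it joins the exceptions, `a` is close to `b` from it on.
    escape : ∀ {a b x} → M.len (to ι a) ≡ M.len b → ¬ Near b x → ∀ F →
             ∃[ i ] (Near b (ν i) × ν i ∉ F × M.rd (to ι a) i ≢ M.rd b i)
    escape {a} {b} {x} len≡ ¬near F with em {P = ∃ (Differ F (f (to ι a)) (f b))}
    ... | no ¬differ = contradiction (a , len≡ , F , λ i _ i∉F → stable λ neq →
            ¬differ (ν i , (λ eq → neq (inE-inj (trans (sym f-own) (trans eq f-own)))) , i∉F)) ¬near
    ... | yes differ with top-own F len≡ differ
    ...   | m , (neq , m∉F) , max = m
            , (a , len≡ , ν m ∷ F , λ i m≤i i∉ → stable λ neq′ →
                i∉ (here (J.antisym (max (ν i)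
                  ((λ eq → neq′ (inE-inj (trans (sym f-own) (trans eq f-own)))) , i∉ ∘ there)) m≤i)))
            , m∉F
            , λ eq → neq (trans f-own (trans (cong inE eq) (sym f-own)))

    -- Together with `close-from-f` this carries closeness from one side to the other, since both
    -- sides share `fa`.
    close-f : ∀ {j a b} → Close j a b → ∃[ F ] (∀ k → j J.≤ k → k ∉ F → fa a k ≡ f b k)
    close-f {j} {a} {b} close@(len≡ , F , agree) = F , agree′
      where
      agree′ : ∀ k → j J.≤ k → k ∉ F → fa a k ≡ f b k
      agree′ k j≤k k∉F with em {P = Own k}
      ... | yes (i , refl) = trans fa-own (trans (cong inE (agree i j≤k k∉F)) (sym f-own))
      ... | no ¬own        = sym (f-near ¬own (close-mono j≤k close))

    close-from-f : ∀ {j a b} F → M.len (to ι a) ≡ M.len b →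
                   (∀ i → j J.≤ ν i → ν i ∉ F → fa a (ν i) ≡ f b (ν i)) → Close j a b
    close-from-f F len≡ agree = len≡ , F , λ i j≤i i∉F →
      inE-inj (trans (sym fa-own) (trans (agree i j≤i i∉F) f-own))

    -- An array that is nowhere finitely close to A, but has a length in A,
    -- determines a cut, and it is starred below it.
    module Cut {a₀ b x₀} (len≡ : M.len (to ι a₀) ≡ M.len b) (¬near : ¬ Near b x₀) where

      -- The array close to `b` agrees with it from `j` on outside `F`, so the difference supplied
      -- by `escape` lies below `j`.
      near-descends : ∀ {j} → Near b j → ∃[ i ] (Near b (ν i) × ν i J.< j × M.InRange (M.len b) i)
      near-descends (a , len≡′ , F , agree) with escape len≡′ ¬near F
      ... | i , near , i∉F , neq = i , near , (λ j≤i → neq (agree i j≤i i∉F)) , M.rd≢⇒inRange len≡′ neq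

      gap : I.Gap (K b)
      gap with escape len≡ ¬near []
      ... | i , near , _ = (σ.to i , char⁺ near) , λ k k∈K → case near-descends (char⁻ k∈K) of λ
              { (i , near , i<k , _) → σ.to i , char⁺ near , i<k ∘ ε-≤⁺ }

      upper : I.UpperSet (K b)
      upper i∈K i≤j = char⁺ (near-mono (ε-≤⁺ i≤j) (char⁻ i∈K))

      cut≢ε : ∀ {n i} → cut (K b) n ≢ ε.to i
      cut≢ε {n} {i} eq with em {P = K b i ≡ true}
      ... | yes i∈K = J.<⇒≢ (cut-below gap n i∈K) eq
      ... | no  i∉K = J.<⇒≢ (cut-above gap upper n i∉K) (sym eq)

      -- Nearness at the cut would descend to an index of M, hence to a member of `K b` below the
      -- cut.
      cut-¬near : ∀ {n} → ¬ Near b (cut (K b) n)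
      cut-¬near {n} near with near-descends near
      ... | i , near′ , i<cut , _ = cut-below gap n (char⁺ near′) (J.<⇒≤ i<cut)

      cut-range : ∀ {n} → Range (size b) (cut (K b) n)
      cut-range {n} = subst (J._≤ cut (K b) n) ν-0# (J.<⇒≤ (cut-above gap upper n 0∉K))
                    , upper-bound
        where
        -- Nearness at 0 would descend to an index in range below 0, so the cut lies above 0.
        0∉K : K b (σ.to M.0#) ≢ true
        0∉K 0∈K with near-descends (char⁻ 0∈K)
        ... | i , _ , i<0 , 0≤i , _ = i<0 (ν-≤⁺ 0≤i)
        upper-bound : cut (K b) n J.≤ size b
        upper-bound with escape len≡ ¬near []
        ... | i , near , _ , neq = J.≤-trans (J.<⇒≤ (cut-below gap n (char⁺ near)))
                                     (ν-≤⁺ (proj₂ (M.rd≢⇒inRange len≡ neq)))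

      f-cut : ∀ n → f b (cut (K b) n) ≡ star
      f-cut n = f-star (λ { (i , eq) → cut≢ε eq }) cut-¬near cut-range (gap , n , refl)

-- Strictly descending sequences

module DescendingSequence (em : EM) {ℓ} {J : Set ℓ} {_≤_ : J → J → Set ℓ}
                          (isTotalOrder : IsTotalOrder _≡_ _≤_)
                          (s : ℕ → J) (descends : ∀ n → ¬ s n ≤ s (suc n)) where

  open Truth em
  open TotalOrder em isTotalOrder

  antitone′ : ∀ {m n} → m ℕ.≤′ n → s n ≤ s m
  antitone′ (ℕ.≤′-reflexive refl) = ≤-refl
  antitone′ (ℕ.≤′-step m≤n)       = ≤-trans (<⇒≤ (descends _)) (antitone′ m≤n)

  strictly-antitone : ∀ {m n} → m ℕ.< n → s n < s m
  strictly-antitone {m} m<n = ≤-<-trans (antitone′ (ℕ.≤⇒≤′ m<n)) (descends m)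

  s-reflects-< : ∀ {m n} → s n < s m → m ℕ.< n
  s-reflects-< sn<sm = ℕ.≰⇒> λ n≤m → sn<sm (antitone′ (ℕ.≤⇒≤′ n≤m))

  eventually-avoids : ∀ F → ∃[ N ] (∀ n → N ℕ.≤ n → s n ∉ F)
  eventually-avoids [] = 0 , λ _ _ ()
  eventually-avoids (y ∷ F) with eventually-avoids F | em {P = ∃[ n ] y ≡ s n}
  ... | N , avoids | no ¬n = N , λ
        { n N≤n (here eq)   → ¬n (n , sym eq)
        ; n N≤n (there n∈F) → avoids n N≤n n∈F }
  ... | N , avoids | yes (k , refl) = N ⊔ suc k , λ
        { n ≤n (here eq)   → <⇒≢ (strictly-antitone (ℕ.m⊔n≤o⇒n≤o N (suc k) ≤n)) eq
        ; n ≤n (there n∈F) → avoids n (ℕ.m⊔n≤o⇒m≤o N (suc k) ≤n) n∈F }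

  -- The least position outside `F` carries the largest term outside `F`, as the sequence descends.
  first-avoiding : ∀ F → ∃[ n ] (s n ∉ F × (∀ m → s n < s m → s m ∈ F))
  first-avoiding F with eventually-avoids F
  ... | N , avoids = search N (avoids N ℕ.≤-refl) (<-wellFounded N)
    where
    search : ∀ n → s n ∉ F → Acc ℕ._<_ n → ∃[ n ] (s n ∉ F × (∀ m → s n < s m → s m ∈ F))
    search n n∉F (acc rs) with em {P = ∃[ m ] (m ℕ.< n × s m ∉ F)}
    ... | yes (m , m<n , m∉F) = search m m∉F (rs m<n)
    ... | no ¬m = n , n∉F , λ m n<m → stable λ m∉F → ¬m (m , s-reflects-< n<m , m∉F)

-- Elements of the amalgam and extensions of the arrays of A

module Amalgam (em : EM) (ext : Ext) {ℓ} (T : IndexTheory ℓ)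
               {A M₁ M₂ : Structure (arrayLanguage T) ℓ}
               (A-model : A ⊨ CARDC T)
               (M₁-model : M₁ ⊨ CARDC T) (M₂-model : M₂ ⊨ CARDC T)
               (ι₁ : Embedding A M₁) (ι₂ : Embedding A M₂)
               {I : Structure (IndexTheory.language T) ℓ}
               (I-model : I ⊨ IndexTheory.axioms T)
               (σ₁ : Embedding (Reduct.reduct T M₁) I) (σ₂ : Embedding (Reduct.reduct T M₂) I)
               (σ-agree : ∀ i → to σ₁ (to ι₁ i) ≡ to σ₂ (to ι₂ i))
               (σ-strong : ∀ i₁ i₂ → to σ₁ i₁ ≡ to σ₂ i₂ → ∃[ i ] (i₁ ≡ to ι₁ i × i₂ ≡ to ι₂ i))
               (filling : CutFilling em T I I-model)
               where

  private module T = IndexTheory T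
  open Truth em
  open CutFilling filling

  module S₁ = Side em ext T I-model filling A-model M₁-model ι₁ σ₁
  module S₂ = Side em ext T I-model filling A-model M₂-model ι₂ σ₂
  open S₁ using (module A; module I; module J; 0J; Range; module ε) public
  module M₁ = S₁.M
  module M₂ = S₂.M

  α≡ : ∀ i → S₁.α i ≡ S₂.α i
  α≡ i = cong ε.to (σ-agree i)

  ν-strong : ∀ {i₁ i₂} → S₁.ν i₁ ≡ S₂.ν i₂ → ∃[ i ] (i₁ ≡ to ι₁ i × i₂ ≡ to ι₂ i)
  ν-strong eq = σ-strong _ _ (ε.injective eq)

  -- The elements of A are represented by left; right (ι₂ e) is junk.
  data Elem : Set ℓ where
    left          : M₁.Elem → Elem
    right         : M₂.Elem → Elem
    fresh₁ fresh₂ : Elem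

  left-injective : ∀ {e e′} → left e ≡ left e′ → e ≡ e′
  left-injective refl = refl

  inE₂ : M₂.Elem → Elem
  inE₂ e with em {P = ∃[ a ] e ≡ to ι₂ a}
  ... | yes (a , _) = left (to ι₁ a)
  ... | no  _       = right e

  inE₂-ι : ∀ {a} → inE₂ (to ι₂ a) ≡ left (to ι₁ a)
  inE₂-ι {a} with em {P = ∃[ a′ ] to ι₂ a ≡ to ι₂ a′}
  ... | yes (a′ , eq) = cong (left ∘ to ι₁) (sym (Embedding.injective ι₂ eq))
  ... | no ¬a         = contradiction (a , refl) ¬a

  inE-strong : ∀ {e₁ e₂} → left e₁ ≡ inE₂ e₂ → ∃[ a ] (e₁ ≡ to ι₁ a × e₂ ≡ to ι₂ a)
  inE-strong {e₁} {e₂} eq with em {P = ∃[ a ] e₂ ≡ to ι₂ a}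
  ... | yes (a , e₂≡) = a , left-injective eq , e₂≡
  inE-strong () | no _

  inE₂-injective : ∀ {e e′} → inE₂ e ≡ inE₂ e′ → e ≡ e′
  inE₂-injective {e} {e′} eq with em {P = ∃[ a ] e ≡ to ι₂ a} | em {P = ∃[ a ] e′ ≡ to ι₂ a}
  ... | yes (a , refl) | yes (a′ , refl) = cong (to ι₂) (Embedding.injective ι₁ (left-injective eq))
  inE₂-injective refl | no _ | no _ = refl
  inE₂-injective () | yes _ | no _
  inE₂-injective () | no _ | yes _

  ⊥E elE : Elem
  ⊥E  = left M₁.undef
  elE = left M₁.el

  inE₂-⊥ : inE₂ M₂.undef ≡ ⊥E
  inE₂-⊥ = trans (cong inE₂ (sym S₂.ι.to-undef)) (trans inE₂-ι (cong left S₁.ι.to-undef))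

  inE₂-el : inE₂ M₂.el ≡ elE
  inE₂-el = trans (cong inE₂ (sym S₂.ι.to-el)) (trans inE₂-ι (cong left S₁.ι.to-el))

  elE≢⊥E : elE ≢ ⊥E
  elE≢⊥E eq = M₁.undef≢el (sym (left-injective eq))

  range₂ : ∀ {a j} → Range (S₁.sizeA a) j → Range (S₂.sizeA a) j
  range₂ {a} {j} = subst (λ l → Range l j) (α≡ _)

  range₁ : ∀ {a j} → Range (S₂.sizeA a) j → Range (S₁.sizeA a) j
  range₁ {a} {j} = subst (λ l → Range l j) (sym (α≡ _))

  abstract

    -- At an index of both sides the two candidates coincide, because the index is in A and both
    -- sides read the same element of A. At an index of neither side the value depends only on the
    -- length.
    fa : A.Array → J.Index → Elem
    fa a j with em {P = S₁.Own j}
    ... | yes (i , _) = left (M₁.rd (to ι₁ a) i)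
    ... | no _ with em {P = S₂.Own j}
    ...   | yes (i , _) = inE₂ (M₂.rd (to ι₂ a) i)
    ...   | no _ with em {P = Range (S₁.sizeA a) j}
    ...     | yes _ = elE
    ...     | no  _ = ⊥E

    fa-own₁ : ∀ {a i} → fa a (S₁.ν i) ≡ left (M₁.rd (to ι₁ a) i)
    fa-own₁ {a} {i} with em {P = S₁.Own (S₁.ν i)}
    ... | yes (k , eq) = cong (left ∘ M₁.rd (to ι₁ a)) (sym (S₁.ν-injective eq))
    ... | no ¬own      = contradiction (i , refl) ¬own

    fa-own₂ : ∀ {a i} → fa a (S₂.ν i) ≡ inE₂ (M₂.rd (to ι₂ a) i)
    fa-own₂ {a} {i} with em {P = S₁.Own (S₂.ν i)}
    ... | yes (k , eq) with ν-strong (sym eq)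
    ...   | x , refl , refl = trans (cong left (sym S₁.ι.to-rd))
              (trans (sym inE₂-ι) (cong inE₂ S₂.ι.to-rd))
    fa-own₂ {a} {i} | no _ with em {P = S₂.Own (S₂.ν i)}
    ... | yes (k , eq) = cong (inE₂ ∘ M₂.rd (to ι₂ a)) (sym (S₂.ν-injective eq))
    ... | no ¬own      = contradiction (i , refl) ¬own

    fa-in : ∀ {a j} → ¬ S₁.Own j → ¬ S₂.Own j → Range (S₁.sizeA a) j → fa a j ≡ elE
    fa-in {a} {j} ¬own₁ ¬own₂ r with em {P = S₁.Own j}
    ... | yes own = contradiction own ¬own₁
    ... | no _ with em {P = S₂.Own j}
    ...   | yes own = contradiction own ¬own₂
    ...   | no _ with em {P = Range (S₁.sizeA a) j}
    ...     | yes _ = refl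
    ...     | no ¬r = contradiction r ¬r

    fa-out : ∀ {a j} → ¬ S₁.Own j → ¬ S₂.Own j → ¬ Range (S₁.sizeA a) j → fa a j ≡ ⊥E
    fa-out {a} {j} ¬own₁ ¬own₂ ¬r with em {P = S₁.Own j}
    ... | yes own = contradiction own ¬own₁
    ... | no _ with em {P = S₂.Own j}
    ...   | yes own = contradiction own ¬own₂
    ...   | no _ with em {P = Range (S₁.sizeA a) j}
    ...     | yes r = contradiction r ¬r
    ...     | no _  = refl

  data Location (j : J.Index) : Set ℓ where
    own₁    : ∀ i → j ≡ S₁.ν i → Location j
    own₂    : ∀ i → j ≡ S₂.ν i → Location j
    neither : ¬ S₁.Own j → ¬ S₂.Own j → Location j

  locate : ∀ j → Location j
  locate j with em {P = S₁.Own j} | em {P = S₂.Own j}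
  ... | yes (i , eq) | _            = own₁ i eq
  ... | no _         | yes (i , eq) = own₂ i eq
  ... | no ¬own₁     | no ¬own₂     = neither ¬own₁ ¬own₂

  fa-neither : ∀ {a a′ j} → ¬ S₁.Own j → ¬ S₂.Own j → A.len a ≡ A.len a′ → fa a j ≡ fa a′ j
  fa-neither {a} {a′} {j} ¬own₁ ¬own₂ len≡ with em {P = Range (S₁.sizeA a) j}
  ... | yes r = trans (fa-in ¬own₁ ¬own₂ r)
                  (sym (fa-in ¬own₁ ¬own₂ (subst (λ l → Range (S₁.α l) j) len≡ r)))
  ... | no ¬r = trans (fa-out ¬own₁ ¬own₂ ¬r)
                  (sym (fa-out ¬own₁ ¬own₂ (subst (λ l → ¬ Range (S₁.α l) j) len≡ ¬r)))

  fa-wr : ∀ {a k e j} → j ≢ S₁.α k → fa (A.wr a k e) j ≡ fa a j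
  fa-wr {a} {k} {e} {j} j≢k with locate j
  ... | own₁ i refl = trans fa-own₁ (trans (cong left (S₁.rd-ι-wr j≢k)) (sym fa-own₁))
  ... | own₂ i refl = trans fa-own₂ (trans
          (cong inE₂ (S₂.rd-ι-wr λ eq → j≢k (trans eq (sym (α≡ k))))) (sym fa-own₂))
  ... | neither ¬own₁ ¬own₂ = fa-neither ¬own₁ ¬own₂ (A.wr-len a k e)

  fa-diff : ∀ {a a′ j} → A.len a ≡ A.len a′ → S₁.α (A.diff a a′) J.< j → fa a j ≡ fa a′ j
  fa-diff {a} {a′} {j} len≡ d<j with locate j
  ... | own₁ i refl = trans fa-own₁ (trans (cong left (S₁.rd-ι-diff d<j)) (sym fa-own₁))
  ... | own₂ i refl = trans fa-own₂ (trans
          (cong inE₂ (S₂.rd-ι-diff (subst (J._< j) (α≡ _) d<j))) (sym fa-own₂))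
  ... | neither ¬own₁ ¬own₂ = fa-neither ¬own₁ ¬own₂ len≡

  fa-inside : ∀ {a j} → Range (S₁.sizeA a) j → fa a j ≢ ⊥E
  fa-inside {a} {j} r eq with locate j
  ... | own₁ i refl = S₁.rd-ι-inside r (left-injective (trans (sym fa-own₁) eq))
  ... | own₂ i refl = S₂.rd-ι-inside (range₂ {a} r)
                        (inE₂-injective (trans (sym fa-own₂) (trans eq (sym inE₂-⊥))))
  ... | neither ¬own₁ ¬own₂ = elE≢⊥E (trans (sym (fa-in ¬own₁ ¬own₂ r)) eq)

  fa-outside : ∀ {a j} → ¬ Range (S₁.sizeA a) j → fa a j ≡ ⊥E
  fa-outside {a} {j} ¬r with locate j
  ... | own₁ i refl = trans fa-own₁ (cong left (S₁.rd-ι-outside ¬r))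
  ... | own₂ i refl = trans fa-own₂ (trans (cong inE₂ (S₂.rd-ι-outside (¬r ∘ range₁ {a}))) inE₂-⊥)
  ... | neither ¬own₁ ¬own₂ = fa-out ¬own₁ ¬own₂ ¬r

  fa-Const : ∀ {i j} → Range (S₁.sizeA (A.Const i)) j → fa (A.Const i) j ≡ elE
  fa-Const {i} {j} r with locate j
  ... | own₁ _ refl = trans fa-own₁ (cong left (S₁.rd-ι-Const r))
  ... | own₂ _ refl = trans fa-own₂ (trans (cong inE₂ (S₂.rd-ι-Const (range₂ {A.Const i} r))) inE₂-el)
  ... | neither ¬own₁ ¬own₂ = fa-in ¬own₁ ¬own₂ r

  elements₁ : S₁.ElementData
  elements₁ = record
    { E = Elem ; ⊥E = ⊥E ; elE = elE ; star = fresh₁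
    ; elE≢⊥ = elE≢⊥E ; star≢⊥ = λ ()
    ; inE = left ; inE-inj = left-injective ; inE-⊥ = refl ; inE-el = refl
    ; fa = fa ; fa-own = fa-own₁ ; fa-wr = fa-wr ; fa-diff = fa-diff
    ; fa-inside = fa-inside ; fa-outside = fa-outside ; fa-Const = fa-Const
    }

  elements₂ : S₂.ElementData
  elements₂ = record
    { E = Elem ; ⊥E = ⊥E ; elE = elE ; star = fresh₂
    ; elE≢⊥ = elE≢⊥E ; star≢⊥ = λ ()
    ; inE = inE₂ ; inE-inj = inE₂-injective ; inE-⊥ = inE₂-⊥ ; inE-el = inE₂-el
    ; fa = fa ; fa-own = fa-own₂
    ; fa-wr = λ j≢k → fa-wr λ eq → j≢k (trans eq (α≡ _))
    ; fa-diff = λ {_} {_} {j} len≡ d<j → fa-diff len≡ (subst (J._< j) (sym (α≡ _)) d<j)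
    ; fa-inside = λ {a} r → fa-inside (range₁ {a} r)
    ; fa-outside = λ {a} ¬r → fa-outside (¬r ∘ range₂ {a})
    ; fa-Const = λ {i} r → fa-Const (range₁ {A.Const i} r)
    }

  module X₁ = S₁.Extend elements₁
  module X₂ = S₂.Extend elements₂
  open Difference em {E = Elem} J.isTotalOrder public

  -- Arrays of equal length from different sides

  module Pair {b₁ b₂} (size≡ : S₁.size b₁ ≡ S₂.size b₂) where

    len₁⇒₂ : ∀ {a} → M₁.len (to ι₁ a) ≡ M₁.len b₁ → M₂.len (to ι₂ a) ≡ M₂.len b₂
    len₁⇒₂ len≡ = S₂.ν-injective (trans S₂.size-ι
      (trans (sym (α≡ _)) (trans (sym S₁.size-ι) (trans (cong S₁.ν len≡) size≡))))

    len₂⇒₁ : ∀ {a} → M₂.len (to ι₂ a) ≡ M₂.len b₂ → M₁.len (to ι₁ a) ≡ M₁.len b₁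
    len₂⇒₁ len≡ = S₁.ν-injective (trans S₁.size-ι
      (trans (α≡ _) (trans (sym S₂.size-ι) (trans (cong S₂.ν len≡) (sym size≡)))))

    -- Strongness of the index amalgam puts the length in A, and `Const` provides the array with
    -- which `escape` starts.
    common-length : ∃[ a ] (M₁.len (to ι₁ a) ≡ M₁.len b₁ × M₂.len (to ι₂ a) ≡ M₂.len b₂)
    common-length with ν-strong size≡
    ... | l , len₁ , len₂ = A.Const l
        , trans (sym S₁.ι.to-len) (trans (cong (to ι₁) Const-len) (sym len₁))
        , trans (sym S₂.ι.to-len) (trans (cong (to ι₂) Const-len) (sym len₂))
      where
      Const-len : A.len (A.Const l) ≡ l
      Const-len = A.Const-len (S₁.ι.≤-from (subst₂ M₁._≤_ (sym S₁.ι.to-0#) len₁ (M₁.0≤len b₁)))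

    -- Agreement at near points makes the two sets `K` equal, so both arrays are starred at the same
    -- `c n`, with distinct values. A difference outside `F` above the first `c n` outside `F` would
    -- be neither near nor old nor starred, but there both arrays read `elE`, or `⊥E` outside their
    -- common range.
    top-at-cut : ∀ F → (∀ x → X₁.Near b₁ x ⊎ X₂.Near b₂ x → x ∉ F → X₁.f b₁ x ≡ X₂.f b₂ x) →
                 (∃[ x ] ¬ X₁.Near b₁ x) → Top (Differ F (X₁.f b₁) (X₂.f b₂))
    top-at-cut F agree (x₀ , ¬near₁) =
      case first-avoiding F of λ { (n , n∉F , earlier) → c n , (c-differs n , n∉F) , maximal n earlier }
      where
      near₁⇒₂ : ∀ {j} → X₁.Near b₁ j → X₂.Near b₂ j
      near₁⇒₂ near@(a , close) with X₁.close-f close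
      ... | F₁ , eq = a , X₂.close-from-f (F ++ F₁) (len₁⇒₂ (proj₁ close)) λ i j≤i i∉ →
            trans (eq _ j≤i (i∉ ∘ ∈-++⁺ʳ F)) (agree _ (inj₁ (X₁.near-mono j≤i near)) (i∉ ∘ ∈-++⁺ˡ))

      near₂⇒₁ : ∀ {j} → X₂.Near b₂ j → X₁.Near b₁ j
      near₂⇒₁ near@(a , close) with X₂.close-f close
      ... | F₁ , eq = a , X₁.close-from-f (F ++ F₁) (len₂⇒₁ (proj₁ close)) λ i j≤i i∉ →
            trans (eq _ j≤i (i∉ ∘ ∈-++⁺ʳ F)) (sym (agree _ (inj₂ (X₂.near-mono j≤i near)) (i∉ ∘ ∈-++⁺ˡ)))

      K≡ : X₁.K b₁ ≡ X₂.K b₂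
      K≡ = ext λ i → bool-cong (char⁺ ∘ near₁⇒₂ ∘ char⁻) (char⁺ ∘ near₂⇒₁ ∘ char⁻)

      module C₁ = X₁.Cut (proj₁ (proj₂ common-length)) ¬near₁
      module C₂ = X₂.Cut (proj₂ (proj₂ common-length)) (¬near₁ ∘ near₂⇒₁)

      c : ℕ → J.Index
      c = cut (X₁.K b₁)

      open DescendingSequence em J.isTotalOrder c (cut-descend C₁.gap)

      f₂-cut : ∀ n → X₂.f b₂ (c n) ≡ fresh₂
      f₂-cut n = subst (λ K → X₂.f b₂ (cut K n) ≡ fresh₂) (sym K≡) (C₂.f-cut n)

      c-differs : ∀ n → X₁.f b₁ (c n) ≢ X₂.f b₂ (c n)
      c-differs n eq = case trans (sym (C₁.f-cut n)) (trans eq (f₂-cut n)) of λ ()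

      module _ n (earlier : ∀ m → c n J.< c m → c m ∈ F)
               {y} (neq : X₁.f b₁ y ≢ X₂.f b₂ y) (y∉F : y ∉ F) (n<y : c n J.< y) where

        ¬near₁-y : ¬ X₁.Near b₁ y
        ¬near₁-y near = neq (agree y (inj₁ near) y∉F)

        ¬near₂-y : ¬ X₂.Near b₂ y
        ¬near₂-y near = neq (agree y (inj₂ near) y∉F)

        -- Indices of `I` in `K` are near, where `agree` excludes a difference; the others lie below
        -- the cut.
        y≢ε : ∀ {i} → y ≢ ε.to i
        y≢ε {i} refl with em {P = X₁.K b₁ i ≡ true}
        ... | yes i∈K = ¬near₁-y (char⁻ i∈K)
        ... | no  i∉K = n<y (J.<⇒≤ (cut-above C₁.gap C₁.upper n i∉K))

        y≢c : ∀ m → y ≢ c m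
        y≢c m refl = y∉F (earlier m n<y)

        agree-at-y : X₁.f b₁ y ≡ X₂.f b₂ y
        agree-at-y with em {P = Range (S₁.size b₁) y}
        ... | yes r = trans (X₁.f-el (λ { (_ , eq) → y≢ε eq }) ¬near₁-y r λ { (_ , m , eq) → y≢c m eq })
                (sym (X₂.f-el (λ { (_ , eq) → y≢ε eq }) ¬near₂-y (subst (λ l → Range l y) size≡ r)
                  λ { (_ , m , eq) → y≢c m (subst (λ K → y ≡ cut K m) (sym K≡) eq) }))
        ... | no ¬r = trans (X₁.f-outside ¬r) (sym (X₂.f-outside (subst (λ l → ¬ Range l y) size≡ ¬r)))

      maximal : ∀ n → (∀ m → c n J.< c m → c m ∈ F) →
                ∀ y → Differ F (X₁.f b₁) (X₂.f b₂) y → y J.≤ c n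
      maximal n earlier y (neq , y∉F) = J.≮⇒≥ λ n<y → neq (agree-at-y n earlier neq y∉F n<y)

    -- If a difference outside `F` occurs where `b₁` is close to `a`, then `ι₂ a` replaces `b₁` from
    -- there on and the pair lies on one side; likewise with the sides exchanged. Otherwise the
    -- arrays agree at all near points outside `F`, as `top-at-cut` requires.
    good : Good (X₁.f b₁) (X₂.f b₂)
    good F (x , dx) with em {P = ∃[ y ] (Differ F (X₁.f b₁) (X₂.f b₂) y × X₁.Near b₁ y)}
                       | em {P = ∃[ y ] (Differ F (X₂.f b₂) (X₁.f b₁) y × X₂.Near b₂ y)}
    ... | yes (y , dy , a , close) | _ with X₁.close-f close
    ...   | F₁ , eq = top-above eq
              (good-cong X₂.f-image (λ _ → refl) (X₂.f-good (len₁⇒₂ (proj₁ close)))) J.≤-refl dy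
    good F (x , dx) | no _ | yes (y , dy , a , close) with X₂.close-f close
    ...   | F₂ , eq with top-above eq
              (good-cong X₁.f-image (λ _ → refl) (X₁.f-good (len₂⇒₁ (proj₁ close)))) J.≤-refl dy
    ...     | m , (neq , m∉F) , max = m , (neq ∘ sym , m∉F) , λ { z (neq′ , z∉F) → max z (neq′ ∘ sym , z∉F) }
    good F (x , dx) | no ¬y₁ | no ¬y₂ = top-at-cut F
      (λ y near y∉F → stable λ neq →
        [ (λ near₁ → ¬y₁ (y , (neq , y∉F) , near₁))
        , (λ near₂ → ¬y₂ (y , (neq ∘ sym , y∉F) , near₂)) ]′ near)
      (x , λ near → ¬y₁ (x , dx , near))

    module Equal (f≡ : ∀ j → X₁.f b₁ j ≡ X₂.f b₂ j) where

      Common : Set ℓ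
      Common = ∃[ a ] (b₁ ≡ to ι₁ a × b₂ ≡ to ι₂ a)

      -- A failure of nearness would create a difference between stars at the cut.
      everywhere-near : ∀ x → X₁.Near b₁ x
      everywhere-near x = stable λ ¬near →
        case top-at-cut [] (λ y _ _ → f≡ y) (x , ¬near) of λ { (m , (neq , _) , _) → neq (f≡ m) }

      common-array : ∀ {a} → b₁ ≡ to ι₁ a → Common
      common-array {a} b₁≡ = a , b₁≡ , X₂.f-injective λ j → trans (sym (f≡ j))
        (trans (cong (λ b → X₁.f b j) b₁≡) (trans (X₁.f-image j) (sym (X₂.f-image j))))

      -- The largest index at which ι₁ a and b₁ differ is also the largest one
      -- at which ι₂ a and b₂ differ, and therefore an index of A.
      differ-in-A : ∀ {a} → M₁.len (to ι₁ a) ≡ M₁.len b₁ → b₁ ≢ to ι₁ a →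
                    ∃[ k ] to ι₁ (A.rd a k) ≢ M₁.rd b₁ (to ι₁ k)
      differ-in-A {a} len≡ b₁≢ with em {P = ∃ (Differ [] (fa a) (X₁.f b₁))}
      ... | no ¬differ = contradiction (X₁.f-injective λ j → trans
              (stable λ neq → ¬differ (j , neq ∘ sym , λ ())) (sym (X₁.f-image j))) b₁≢
      ... | yes (x , neq , _)
        with X₁.top-own [] len≡ (x , image-b₁ neq , λ ())
           | X₂.top-own [] (len₁⇒₂ len≡) (x , image-b₂ neq , λ ())
        where
        image-b₁ : ∀ {y} → fa a y ≢ X₁.f b₁ y → X₁.f (to ι₁ a) y ≢ X₁.f b₁ y
        image-b₁ {y} neq eq = neq (trans (sym (X₁.f-image y)) eq)
        image-b₂ : ∀ {y} → fa a y ≢ X₁.f b₁ y → X₂.f (to ι₂ a) y ≢ X₂.f b₂ y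
        image-b₂ {y} neq eq = neq (trans (sym (X₂.f-image y)) (trans eq (sym (f≡ y))))
      ...   | m₁ , (neq₁ , _) , max₁ | m₂ , (neq₂ , _) , max₂ =
        case ν-strong (J.antisym (max₂ _ ((λ eq → neq₁ (to-side₁ eq)) , λ ()))
                                 (max₁ _ ((λ eq → neq₂ (to-side₂ eq)) , λ ()))) of λ
          { (k , refl , _) → k , λ eq → neq₁ (trans X₁.f-own
              (trans (cong left (trans (sym S₁.ι.to-rd) eq)) (sym X₁.f-own))) }
        where
        image≡ : ∀ y → X₁.f (to ι₁ a) y ≡ X₂.f (to ι₂ a) y
        image≡ y = trans (X₁.f-image y) (sym (X₂.f-image y))
        to-side₁ : ∀ {y} → X₂.f (to ι₂ a) y ≡ X₂.f b₂ y → X₁.f (to ι₁ a) y ≡ X₁.f b₁ y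
        to-side₁ {y} eq = trans (image≡ y) (trans eq (sym (f≡ y)))
        to-side₂ : ∀ {y} → X₁.f (to ι₁ a) y ≡ X₁.f b₁ y → X₂.f (to ι₂ a) y ≡ X₂.f b₂ y
        to-side₂ {y} eq = trans (sym (image≡ y)) (trans eq (f≡ y))

      -- Only indices of A are compared. At one of them in `F`, `b₁` and `b₂` have the same value in
      -- the amalgam, so by `inE-strong` it is an element of A and can be written into `a`. When `F`
      -- is exhausted, `differ-in-A` leaves only `b₁ ≡ ι₁ a`.
      correct : ∀ F {a} → M₁.len (to ι₁ a) ≡ M₁.len b₁ →
                (∀ k → S₁.α k ∉ F → to ι₁ (A.rd a k) ≡ M₁.rd b₁ (to ι₁ k)) → Common
      correct [] {a} len≡ agree with em {P = b₁ ≡ to ι₁ a}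
      ... | yes b₁≡ = common-array b₁≡
      ... | no  b₁≢ with differ-in-A len≡ b₁≢
      ...   | k , neq = contradiction (agree k λ ()) neq
      correct (x ∷ F) {a} len≡ agree with em {P = ∃[ k ] x ≡ S₁.α k}
      ... | no ¬k = correct F len≡ λ k k∉F → agree k λ
              { (here k≡x) → ¬k (k , sym k≡x) ; (there k∈F) → k∉F k∈F }
      ... | yes (k , refl) with inE-strong (trans (sym X₁.f-own) (trans (f≡ (S₁.α k))
              (trans (cong (X₂.f b₂) (α≡ k)) X₂.f-own)))
      ...   | e , rd≡e , _ = correct F (trans (cong M₁.len S₁.ι.to-wr) (trans (M₁.wr-len _ _ _) len≡)) agree′
        where
        agree′ : ∀ i → S₁.α i ∉ F → to ι₁ (A.rd (A.wr a k e) i) ≡ M₁.rd b₁ (to ι₁ i)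
        agree′ i i∉F with em {P = k ≡ i}
        ... | yes refl = trans S₁.ι.to-rd (trans (cong (λ y → M₁.rd y (to ι₁ k))
                (trans S₁.ι.to-wr (cong (M₁.wr (to ι₁ a) (to ι₁ k)) (sym rd≡e)))) (M₁.rd-wr-rd (sym len≡)))
        ... | no k≢i = trans (cong (to ι₁) (A.rd-wr-other k≢i)) (agree i λ
                { (here i≡k) → k≢i (S₁.α-injective (sym i≡k)) ; (there i∈F) → i∉F i∈F })

      -- Nearness at `0J` covers the whole range, so some `a` agrees with `b₁` up to finitely many
      -- indices.
      common : Common
      common with everywhere-near 0J
      ... | a , len≡ , F , agree = correct F len≡ λ k k∉F → trans S₁.ι.to-rd (stable λ neq →
            neq (agree _ (proj₁ (S₁.range-ν⁺ (M₁.rd≢⇒inRange len≡ neq))) k∉F))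

  -- The arrays of the amalgam and their operations

  data Base : Set ℓ where
    from₁    : M₁.Array → Base
    from₂    : M₂.Array → Base
    -- `Const` must be defined on all of `J`, including lengths that occur on neither side.
    constant : J.Index → Base

  constant-at : J.Index → J.Index → Elem
  constant-at l j with em {P = Range l j}
  ... | yes _ = elE
  ... | no  _ = ⊥E

  constant-inside : ∀ {l j} → Range l j → constant-at l j ≡ elE
  constant-inside {l} {j} r with em {P = Range l j}
  ... | yes _ = refl
  ... | no ¬r = contradiction r ¬r

  constant-outside : ∀ {l j} → ¬ Range l j → constant-at l j ≡ ⊥E
  constant-outside {l} {j} ¬r with em {P = Range l j}
  ... | yes r = contradiction r ¬r
  ... | no _  = refl

  baseSize : Base → J.Index
  baseSize (from₁ b)    = S₁.size b
  baseSize (from₂ b)    = S₂.size b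
  baseSize (constant l) = l

  value : Base → J.Index → Elem
  value (from₁ b)    = X₁.f b
  value (from₂ b)    = X₂.f b
  value (constant l) = constant-at l

  good-refl : ∀ {g} → Good g g
  good-refl F (_ , neq , _) = contradiction refl neq

  constant-f₁ : ∀ b j → X₁.f (M₁.Const (M₁.len b)) j ≡ constant-at (S₁.size b) j
  constant-f₁ b j with em {P = Range (S₁.size b) j}
  ... | yes r = X₁.f-Const (subst (λ l → Range (S₁.ν l) j) (sym (M₁.Const-len (M₁.0≤len b))) r)
  ... | no ¬r = X₁.f-outside (subst (λ l → ¬ Range (S₁.ν l) j) (sym (M₁.Const-len (M₁.0≤len b))) ¬r)

  constant-f₂ : ∀ b j → X₂.f (M₂.Const (M₂.len b)) j ≡ constant-at (S₂.size b) j
  constant-f₂ b j with em {P = Range (S₂.size b) j}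
  ... | yes r = X₂.f-Const (subst (λ l → Range (S₂.ν l) j) (sym (M₂.Const-len (M₂.0≤len b))) r)
  ... | no ¬r = X₂.f-outside (subst (λ l → ¬ Range (S₂.ν l) j) (sym (M₂.Const-len (M₂.0≤len b))) ¬r)

  -- A constant array with the length of `b` is the extension of one from the side of `b`.
  good-constant₁ : ∀ b → Good (constant-at (S₁.size b)) (X₁.f b)
  good-constant₁ b = good-cong (constant-f₁ b) (λ _ → refl) (X₁.f-good (M₁.Const-len (M₁.0≤len b)))

  good-constant₂ : ∀ b → Good (constant-at (S₂.size b)) (X₂.f b)
  good-constant₂ b = good-cong (constant-f₂ b) (λ _ → refl) (X₂.f-good (M₂.Const-len (M₂.0≤len b)))

  value-good : ∀ β γ → baseSize β ≡ baseSize γ → Good (value β) (value γ)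
  value-good (from₁ b)    (from₁ c)    eq   = X₁.f-good (S₁.ν-injective eq)
  value-good (from₁ b)    (from₂ c)    eq   = Pair.good eq
  value-good (from₁ b)    (constant _) refl = good-sym (good-constant₁ b)
  value-good (from₂ b)    (from₁ c)    eq   = good-sym (Pair.good (sym eq))
  value-good (from₂ b)    (from₂ c)    eq   = X₂.f-good (S₂.ν-injective eq)
  value-good (from₂ b)    (constant _) refl = good-sym (good-constant₂ b)
  value-good (constant _) (from₁ c)    refl = good-constant₁ c
  value-good (constant _) (from₂ c)    refl = good-constant₂ c
  value-good (constant l) (constant _) refl = good-refl

  -- The last clause provides largest differences: any two bases of equal size are `Good`, and this
  -- survives finite modification.
  WellFormed : (J.Index → Elem) → J.Index → Set ℓ
  WellFormed g l =
    0J J.≤ l × (∀ {j} → Range l j → g j ≢ ⊥E) × (∀ {j} → ¬ Range l j → g j ≡ ⊥E) ×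
    ∃[ β ] (baseSize β ≡ l × ∃[ F ] (∀ j → j ∉ F → value β j ≡ g j))

  -- Well-formedness is irrelevant, so that arrays with the same values are equal whatever their
  -- bases; `recompute` recovers it.
  record Array : Set ℓ where
    constructor array
    field
      at          : J.Index → Elem
      len         : J.Index
      .wellFormed : WellFormed at len

  open Array using (at; len)

  wf : ∀ x → WellFormed (at x) (len x)
  wf (array _ _ w) = recompute em w

  0≤len : ∀ x → 0J J.≤ len x
  0≤len x = proj₁ (wf x)

  at-inside : ∀ x {j} → Range (len x) j → at x j ≢ ⊥E
  at-inside x = proj₁ (proj₂ (wf x))

  at-outside : ∀ x {j} → ¬ Range (len x) j → at x j ≡ ⊥E
  at-outside x = proj₁ (proj₂ (proj₂ (wf x)))

  at-defined : ∀ x {j} → at x j ≢ ⊥E → Range (len x) j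
  at-defined x neq = stable λ ¬r → neq (at-outside x ¬r)

  len-≤ : ∀ {x y} → (∀ j → at x j ≡ at y j) → len x J.≤ len y
  len-≤ {x} {y} eq = proj₂ (at-defined y λ y≡⊥ → at-inside x (0≤len x , J.≤-refl) (trans (eq _) y≡⊥))

  array-≡ : ∀ {x y} → (∀ j → at x j ≡ at y j) → x ≡ y
  array-≡ {x} {y} eq = helper (ext eq) (J.antisym (len-≤ {x} {y} eq) (len-≤ {y} {x} (sym ∘ eq)))
    where
    helper : at x ≡ at y → len x ≡ len y → x ≡ y
    helper refl refl = refl

  array-good : ∀ x y → len x ≡ len y → Good (at x) (at y)
  array-good x y eq with wf x | wf y
  ... | _ , _ , _ , β , βx , F , β≈x | _ , _ , _ , γ , γy , G , γ≈y =
        good-modify F β≈x (good-sym (good-modify G γ≈y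
          (good-sym (value-good β γ (trans βx (trans eq (sym γy)))))))

  Difference : Array → Array → J.Index → Set ℓ
  Difference x y = Differ [] (at x) (at y)

  -- Only `y` is defined at its last index, and neither array is defined beyond it.
  length-top : ∀ x y → len x J.< len y → Top (Difference x y)
  length-top x y x<y = len y
    , ((λ eq → at-inside y (0≤len y , J.≤-refl) (trans (sym eq)
                 (at-outside x λ { (_ , y≤x) → x<y y≤x }))) , λ ())
    , λ { j (neq , _) → J.≮⇒≥ λ y<j → neq (trans
            (at-outside x λ { (_ , j≤x) → J.<-trans x<y y<j j≤x })
            (sym (at-outside y λ { (_ , j≤y) → y<j j≤y }))) }

  top-sym : ∀ x y → Top (Difference x y) → Top (Difference y x)
  top-sym x y (m , (neq , _) , max) =
    m , (neq ∘ sym , λ ()) , λ { j (neq′ , _) → max j (neq′ ∘ sym , λ ()) }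

  array-top : ∀ {x y} → x ≢ y → Top (Difference x y)
  array-top {x} {y} x≢y with em {P = len x J.≤ len y} | em {P = len y J.≤ len x}
  ... | no x≰y  | _       = top-sym y x (length-top y x x≰y)
  ... | yes _   | no y≰x  = length-top x y y≰x
  ... | yes x≤y | yes y≤x = array-good x y (J.antisym x≤y y≤x) []
        (stable λ ¬d → x≢y (array-≡ λ j → stable λ neq → ¬d (j , neq , λ ())))

  diffᴹ : Array → Array → J.Index
  diffᴹ x y with em {P = Top (Difference x y)}
  ... | yes (m , _) = m
  -- By `array-top` this happens only for equal arrays, where `diff-≡` prescribes 0.
  ... | no  _       = 0J

  diff-top : ∀ x y {m} → Difference x y m → (∀ j → Difference x y j → j J.≤ m) → diffᴹ x y ≡ m
  diff-top x y {m} dm max with em {P = Top (Difference x y)}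
  ... | yes (m′ , dm′ , max′) = J.antisym (max m′ dm′) (max′ m dm)
  ... | no ¬top               = contradiction (m , dm , max) ¬top

  diff-refl : ∀ x → diffᴹ x x ≡ 0J
  diff-refl x with em {P = Top (Difference x x)}
  ... | yes (_ , (neq , _) , _) = contradiction refl neq
  ... | no _                    = refl

  diff-separates : ∀ {x y} → x ≢ y → at x (diffᴹ x y) ≢ at y (diffᴹ x y)
  diff-separates {x} {y} x≢y with em {P = Top (Difference x y)}
  ... | yes (_ , (neq , _) , _) = neq
  ... | no ¬top                 = contradiction (array-top x≢y) ¬top

  diff-maximal : ∀ {x y i} → diffᴹ x y J.< i → at x i ≡ at y i
  diff-maximal {x} {y} {i} d<i with em {P = Top (Difference x y)}
  ... | yes (m , _ , max) = stable λ neq → d<i (max i (neq , λ ()))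
  ... | no ¬top           = stable λ neq → ¬top (array-top {x} {y} λ x≡y → neq (cong (λ z → at z i) x≡y))

  update : (J.Index → Elem) → J.Index → Elem → J.Index → Elem
  update g i e j with em {P = j ≡ i}
  ... | yes _ = e
  ... | no  _ = g j

  update-same : ∀ {g i e} → update g i e i ≡ e
  update-same {i = i} with em {P = i ≡ i}
  ... | yes _   = refl
  ... | no ¬i≡i = contradiction refl ¬i≡i

  update-other : ∀ {g i e j} → j ≢ i → update g i e j ≡ g j
  update-other {i = i} {j = j} j≢i with em {P = j ≡ i}
  ... | yes j≡i = contradiction j≡i j≢i
  ... | no _    = refl

  update-wellFormed : ∀ {g l i e} → e ≢ ⊥E → Range l i → WellFormed g l → WellFormed (update g i e) l
  update-wellFormed {g} {l} {i} {e} e≢⊥ r (0≤l , inside , outside , β , size≡ , F , β≈g) =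
    0≤l , inside′ , outside′ , β , size≡ , i ∷ F , λ j j∉ →
      trans (β≈g j (j∉ ∘ there)) (sym (update-other λ { refl → j∉ (here refl) }))
    where
    inside′ : ∀ {j} → Range l j → update g i e j ≢ ⊥E
    inside′ {j} r′ with em {P = j ≡ i}
    ... | yes _ = e≢⊥
    ... | no _  = inside r′
    outside′ : ∀ {j} → ¬ Range l j → update g i e j ≡ ⊥E
    outside′ {j} ¬r with em {P = j ≡ i}
    ... | yes refl = contradiction r ¬r
    ... | no _     = outside ¬r

  -- The length fixes where an array is defined, so writing `⊥E`, or writing out of range, has to
  -- leave it unchanged.
  wrᴹ : Array → J.Index → Elem → Array
  wrᴹ x i e with em {P = e ≢ ⊥E × Range (len x) i}
  ... | yes (e≢⊥ , r) = array (update (at x) i e) (len x) (update-wellFormed e≢⊥ r (wf x))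
  ... | no _          = x

  wr-len : ∀ x i e → len (wrᴹ x i e) ≡ len x
  wr-len x i e with em {P = e ≢ ⊥E × Range (len x) i}
  ... | yes _ = refl
  ... | no _  = refl

  wr-noop : ∀ {x i e} → ¬ (e ≢ ⊥E × Range (len x) i) → wrᴹ x i e ≡ x
  wr-noop {x} {i} {e} ¬p with em {P = e ≢ ⊥E × Range (len x) i}
  ... | yes p = contradiction p ¬p
  ... | no _  = refl

  at-wr-same : ∀ {x i e} → e ≢ ⊥E → Range (len x) i → at (wrᴹ x i e) i ≡ e
  at-wr-same {x} {i} {e} e≢⊥ r with em {P = e ≢ ⊥E × Range (len x) i}
  ... | yes _ = update-same
  ... | no ¬p = contradiction (e≢⊥ , r) ¬p

  at-wr-other : ∀ {x i e j} → j ≢ i → at (wrᴹ x i e) j ≡ at x j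
  at-wr-other {x} {i} {e} j≢i with em {P = e ≢ ⊥E × Range (len x) i}
  ... | yes _ = update-other j≢i
  ... | no _  = refl

  maxᴹ : J.Index → J.Index
  maxᴹ i = Structure.⟦_⟧ᶠ J T.max (i ∷ 0J ∷ [])

  0≤max : ∀ i → 0J J.≤ maxᴹ i
  0≤max i with J.total i 0J
  ... | inj₁ i≤0 = subst (0J J.≤_) (sym (proj₁ (J.isMax i 0J) i≤0)) J.≤-refl
  ... | inj₂ 0≤i = subst (0J J.≤_) (sym (proj₂ (J.isMax i 0J) 0≤i)) 0≤i

  Constᴹ : J.Index → Array
  Constᴹ i = array (constant-at (maxᴹ i)) (maxᴹ i)
    ( 0≤max i , (λ r eq → elE≢⊥E (trans (sym (constant-inside r)) eq)) , constant-outside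
    , constant (maxᴹ i) , refl , [] , λ _ _ → refl)

  -- The amalgam as a model

  Carrierᴹ : Sort → Set ℓ
  Carrierᴹ ARRAY = Array
  Carrierᴹ ELEM  = Elem
  Carrierᴹ INDEX = J.Index

  open Reduct T

  𝕄 : Structure (arrayLanguage T) ℓ
  𝕄 = record { Carrier = Carrierᴹ ; ⟦_⟧ᶠ = fun ; ⟦_⟧ʳ = rel′ }
    where
    fun : ∀ {Δ s} → ArrayFun T Δ s → All Carrierᴹ Δ → Carrierᴹ s
    fun (index F) xs               = Structure.⟦_⟧ᶠ J F (unindexed Carrierᴹ xs)
    fun rdˢ       (y ∷ i ∷ [])     = at y i
    fun wrˢ       (y ∷ i ∷ e ∷ []) = wrᴹ y i e
    fun diffˢ     (x ∷ y ∷ [])     = diffᴹ x y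
    fun lenˢ      (y ∷ [])         = len y
    fun constˢ    (i ∷ [])         = Constᴹ i
    fun ⊥ˢ        []               = ⊥E
    fun elˢ       []               = elE
    rel′ : ∀ {Δ} → ArrayRel T Δ → All Carrierᴹ Δ → Set ℓ
    rel′ (index R) xs = Structure.⟦_⟧ʳ J R (unindexed Carrierᴹ xs)

  -- It transports the index axioms from `J` to `𝕄`, whose index operations repack their argument
  -- lists.
  J-reduct : Embedding J (reduct 𝕄)
  J-reduct = record
    { to        = λ j → j
    ; injective = λ eq → eq
    ; to-fun    = λ F xs → cong (Structure.⟦_⟧ᶠ J F) (sym (round-trip xs))
    ; to-rel    = λ R xs → mk⇔ (subst (Structure.⟦_⟧ʳ J R) (sym (round-trip xs)))
                               (subst (Structure.⟦_⟧ʳ J R) (round-trip xs))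
    }
    where
    round-trip : ∀ {Δ} (xs : All (λ _ → J.Index) Δ) →
                 unindexed Carrierᴹ (indexed Carrierᴹ (All.map (λ j → j) xs)) ≡ xs
    round-trip xs = trans (unindexed-indexed Carrierᴹ _) (All.map-id xs)

  𝕄-CARD : IsModel 𝕄 (CARD T)
  𝕄-CARD (index {universal Γ φ} σ∈T) ρ =
    subst (λ ρ → Holds 𝕄 ρ (⌈_⌉ᶠ T φ))
      (trans (cong (indexed Carrierᴹ) (All.map-id _)) (indexed-unindexed Carrierᴹ ρ))
      (Equivalence.from (holds-reduct 𝕄 _ φ) (Equivalence.to (holds-embedding J-reduct _ φ)
        (satisfies J-model σ∈T (unindexed Carrierᴹ ρ))))
  𝕄-CARD len-wr (y ∷ i ∷ e ∷ []) = wr-len y i e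
  𝕄-CARD wr-⊥ (y ∷ i ∷ []) = wr-noop λ { (neq , _) → neq refl }
  𝕄-CARD rd-wr-≡ (y ∷ i ∷ e ∷ []) (e≢⊥ , r) = at-wr-same {y} (λ eq → ⊥-elim (e≢⊥ eq)) r
  𝕄-CARD rd-wr-≢ (y ∷ i ∷ j ∷ e ∷ []) i≢j = at-wr-other {y} (λ eq → ⊥-elim (i≢j (sym eq)))
  𝕄-CARD rd-≢⊥ (y ∷ i ∷ []) =
    (λ neq → at-defined y λ eq → ⊥-elim (neq eq)) , λ r eq → contradiction eq (at-inside y r)
  𝕄-CARD len-≥0 (y ∷ []) = 0≤len y
  𝕄-CARD diff-≡ (y ∷ []) = diff-refl y
  𝕄-CARD diff-≢ (x ∷ y ∷ []) x≢y eq =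
    contradiction eq (diff-separates {x} {y} λ x≡y → ⊥-elim (x≢y x≡y))
  𝕄-CARD diff-max (x ∷ y ∷ i ∷ []) (d≤i , d≢i) =
    diff-maximal {x} {y} λ i≤d → ⊥-elim (d≢i (J.antisym d≤i i≤d))
  𝕄-CARD ⊥≢el [] eq = contradiction (sym eq) elE≢⊥E

  𝕄-model : IsModel 𝕄 (CARDC T)
  𝕄-model (card {σ} σ∈CARD)   = 𝕄-CARD {σ} σ∈CARD
  𝕄-model len-Const (i ∷ [])    = refl
  𝕄-model rd-Const (i ∷ j ∷ []) = constant-inside

  -- The two embeddings and strongness

  module Inclusion {M : Structure (arrayLanguage T) ℓ} (M-model : M ⊨ CARDC T) where

    private module M = ArrayModel em T M M-model

    module _
      (ν : Embedding (reduct M) J)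
      (inE : M.Elem → Elem) (inE-injective : ∀ {e e′} → inE e ≡ inE e′ → e ≡ e′)
      (inE-⊥ : inE M.undef ≡ ⊥E) (inE-el : inE M.el ≡ elE)
      (f : M.Array → J.Index → Elem)
      (f-wellFormed : ∀ b → WellFormed (f b) (to ν (M.len b)))
      (f-own : ∀ {b i} → f b (to ν i) ≡ inE (M.rd b i))
      (f-wr : ∀ {b i e j} → j ≢ to ν i → f (M.wr b i e) j ≡ f b j)
      (f-diff : ∀ {b b′ j} → to ν (M.diff b b′) J.< j → f b j ≡ f b′ j)
      (f-Const : ∀ {i j} → Range (to ν (M.len (M.Const i))) j → f (M.Const i) j ≡ elE)
      where

      private module ν = Embedding ν

      ν-0# : ν.to M.0# ≡ 0J
      ν-0# = ν.to-fun T.zeroᵢ []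

      extend : M.Array → Array
      extend b = array (f b) (ν.to (M.len b)) (f-wellFormed b)

      include : ∀ {s} → Carrier M s → Carrierᴹ s
      include {ARRAY} = extend
      include {ELEM}  = inE
      include {INDEX} = ν.to

      include-injective : ∀ {s} {x y : Carrier M s} → include x ≡ include y → x ≡ y
      include-injective {ARRAY} eq = M.array-ext λ i →
        inE-injective (trans (sym f-own) (trans (cong (λ x → at x (ν.to i)) eq) f-own))
      include-injective {ELEM}  = inE-injective
      include-injective {INDEX} = ν.injective

      extend-wr : ∀ b i e → extend (M.wr b i e) ≡ wrᴹ (extend b) (ν.to i) (inE e)
      extend-wr b i e = array-≡ λ j → pointwise j
        where
        off : ∀ {j} → j ≢ ν.to i → at (extend (M.wr b i e)) j ≡ at (wrᴹ (extend b) (ν.to i) (inE e)) j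
        off j≢i = trans (f-wr j≢i) (sym (at-wr-other {extend b} j≢i))
        range⁻ : Range (ν.to (M.len b)) (ν.to i) → M.InRange (M.len b) i
        range⁻ (p , q) = Equivalence.from (ν.to-rel T.leq _) (subst (J._≤ ν.to i) (sym ν-0#) p)
                       , Equivalence.from (ν.to-rel T.leq _) q
        range⁺ : M.InRange (M.len b) i → Range (ν.to (M.len b)) (ν.to i)
        range⁺ (p , q) = subst (J._≤ ν.to i) ν-0# (Equivalence.to (ν.to-rel T.leq _) p)
                       , Equivalence.to (ν.to-rel T.leq _) q
        unchanged : ¬ (inE e ≢ ⊥E × Range (ν.to (M.len b)) (ν.to i)) → M.rd (M.wr b i e) i ≡ M.rd b i
        unchanged ¬p with em {P = e ≡ M.undef}
        ... | yes refl = cong (λ y → M.rd y i) (M.wr-undef b i)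
        ... | no e≢⊥   = trans (M.rd-outside (subst (λ l → ¬ M.InRange l i) (sym (M.wr-len b i e)) ¬r))
                               (sym (M.rd-outside ¬r))
          where
          ¬r : ¬ M.InRange (M.len b) i
          ¬r r = ¬p ((λ eq → e≢⊥ (inE-injective (trans eq (sym inE-⊥)))) , range⁺ r)
        on : Dec (inE e ≢ ⊥E × Range (ν.to (M.len b)) (ν.to i)) →
             at (extend (M.wr b i e)) (ν.to i) ≡ at (wrᴹ (extend b) (ν.to i) (inE e)) (ν.to i)
        on (yes (e≢⊥ , r)) = trans f-own (trans
          (cong inE (M.rd-wr-same (λ { refl → e≢⊥ inE-⊥ }) (range⁻ r)))
          (sym (at-wr-same {extend b} e≢⊥ r)))
        on (no ¬p) = trans f-own (trans (cong inE (unchanged ¬p)) (trans (sym f-own)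
          (cong (λ x → at x (ν.to i)) (sym (wr-noop {extend b} ¬p)))))
        pointwise : ∀ j → at (extend (M.wr b i e)) j ≡ at (wrᴹ (extend b) (ν.to i) (inE e)) j
        pointwise j = case em {P = j ≡ ν.to i} of λ { (yes refl) → on em ; (no j≢i) → off j≢i }

      extend-diff : ∀ b b′ → ν.to (M.diff b b′) ≡ diffᴹ (extend b) (extend b′)
      extend-diff b b′ with em {P = b ≡ b′}
      ... | yes refl = trans (cong ν.to (M.diff-self b)) (trans ν-0# (sym (diff-refl (extend b))))
      ... | no b≢b′  = sym (diff-top (extend b) (extend b′)
            ((λ eq → M.diff-separates b≢b′ (inE-injective (trans (sym f-own) (trans eq f-own)))) , λ ())
            λ { j (neq , _) → J.≮⇒≥ λ d<j → neq (f-diff d<j) })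

      extend-Const : ∀ i → extend (M.Const i) ≡ Constᴹ (ν.to i)
      extend-Const i = array-≡ pointwise
        where
        len≡ : ν.to (M.len (M.Const i)) ≡ maxᴹ (ν.to i)
        len≡ = trans (cong ν.to (M.Const-len-max i)) (trans (ν.to-fun T.max _)
          (cong (λ z → Structure.⟦_⟧ᶠ J T.max (ν.to i ∷ z ∷ [])) ν-0#))
        pointwise : ∀ j → f (M.Const i) j ≡ constant-at (maxᴹ (ν.to i)) j
        pointwise j = case em {P = Range (maxᴹ (ν.to i)) j} of λ
          { (yes r) → trans (f-Const (subst (λ l → Range l j) (sym len≡) r)) (sym (constant-inside r))
          ; (no ¬r) → trans (at-outside (extend (M.Const i)) (subst (λ l → ¬ Range l j) (sym len≡) ¬r))
                            (sym (constant-outside ¬r)) }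

      unindexed-include : ∀ {Δ} (xs : All (Carrier M) (indices T Δ)) →
                          unindexed Carrierᴹ (All.map include xs) ≡
                          All.map (λ {_} → ν.to) (unindexed (Carrier M) xs)
      unindexed-include = map-unindexed include

      include-fun : ∀ {Δ s} (F : ArrayFun T Δ s) (xs : All (Carrier M) Δ) →
                    include (Structure.⟦_⟧ᶠ M F xs) ≡ Structure.⟦_⟧ᶠ 𝕄 F (All.map include xs)
      include-fun (index F) xs =
        trans (cong (ν.to ∘ Structure.⟦_⟧ᶠ M (index F)) (sym (indexed-unindexed (Carrier M) xs)))
          (trans (ν.to-fun F _) (cong (Structure.⟦_⟧ᶠ J F) (sym (unindexed-include xs))))
      include-fun rdˢ    (y ∷ i ∷ [])     = sym f-own
      include-fun wrˢ    (y ∷ i ∷ e ∷ []) = extend-wr y i e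
      include-fun diffˢ  (x ∷ y ∷ [])     = extend-diff x y
      include-fun lenˢ   (y ∷ [])         = refl
      include-fun constˢ (i ∷ [])         = extend-Const i
      include-fun ⊥ˢ     []               = inE-⊥
      include-fun elˢ    []               = inE-el

      include-rel : ∀ {Δ} (R : ArrayRel T Δ) (xs : All (Carrier M) Δ) →
                    Structure.⟦_⟧ʳ M R xs ⇔ Structure.⟦_⟧ʳ 𝕄 R (All.map include xs)
      include-rel (index R) xs = mk⇔
        (subst (Structure.⟦_⟧ʳ J R) (sym (unindexed-include xs)) ∘ Equivalence.to (ν.to-rel R _)
          ∘ subst (Structure.⟦_⟧ʳ M (index R)) (sym (indexed-unindexed (Carrier M) xs)))
        (subst (Structure.⟦_⟧ʳ M (index R)) (indexed-unindexed (Carrier M) xs)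
          ∘ Equivalence.from (ν.to-rel R _) ∘ subst (Structure.⟦_⟧ʳ J R) (unindexed-include xs))

      inclusion : Embedding M 𝕄
      inclusion = record
        { to = include ; injective = include-injective ; to-fun = include-fun ; to-rel = include-rel }

  f₁-wellFormed : ∀ b → WellFormed (X₁.f b) (S₁.size b)
  f₁-wellFormed b = subst (J._≤ S₁.size b) S₁.ν-0# (S₁.ν-≤⁺ (M₁.0≤len b))
    , X₁.f-inside , X₁.f-outside , from₁ b , refl , [] , λ _ _ → refl

  f₂-wellFormed : ∀ b → WellFormed (X₂.f b) (S₂.size b)
  f₂-wellFormed b = subst (J._≤ S₂.size b) S₂.ν-0# (S₂.ν-≤⁺ (M₂.0≤len b))
    , X₂.f-inside , X₂.f-outside , from₂ b , refl , [] , λ _ _ → refl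

  μ₁ : Embedding M₁ 𝕄
  μ₁ = Inclusion.inclusion M₁-model (embedding-∘ ε σ₁) left left-injective refl refl
         X₁.f f₁-wellFormed X₁.f-own X₁.f-wr X₁.f-diff X₁.f-Const

  μ₂ : Embedding M₂ 𝕄
  μ₂ = Inclusion.inclusion M₂-model (embedding-∘ ε σ₂) inE₂ inE₂-injective inE₂-⊥ inE₂-el
         X₂.f f₂-wellFormed X₂.f-own X₂.f-wr X₂.f-diff X₂.f-Const

  agree-on-A : ∀ {s} (a : Carrier A s) → to μ₁ (to ι₁ a) ≡ to μ₂ (to ι₂ a)
  agree-on-A {ARRAY} a = array-≡ λ j → trans (X₁.f-image j) (sym (X₂.f-image j))
  agree-on-A {ELEM}  e = sym inE₂-ι
  agree-on-A {INDEX} i = α≡ i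

  strong : ∀ {s} (m₁ : Carrier M₁ s) (m₂ : Carrier M₂ s) → to μ₁ m₁ ≡ to μ₂ m₂ →
           ∃[ a ] (m₁ ≡ to ι₁ a × m₂ ≡ to ι₂ a)
  strong {ARRAY} b₁ b₂ eq = Pair.Equal.common (cong len eq) λ j → cong (λ x → at x j) eq
  strong {ELEM}  e₁ e₂    = inE-strong
  strong {INDEX} i₁ i₂    = ν-strong

  strong-amalgam :
    Σ[ N ∈ Structure (arrayLanguage T) ℓ ] IsModel N (CARDC T) ×
    Σ[ μ₁ ∈ Embedding M₁ N ] Σ[ μ₂ ∈ Embedding M₂ N ]
      (∀ {s} (a : Carrier A s) → to μ₁ (to ι₁ a) ≡ to μ₂ (to ι₂ a)) ×
      (∀ {s} (m₁ : Carrier M₁ s) (m₂ : Carrier M₂ s) → to μ₁ m₁ ≡ to μ₂ m₂ →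
         ∃[ a ] (m₁ ≡ to ι₁ a × m₂ ≡ to ι₂ a))
  strong-amalgam = 𝕄 , 𝕄-model , μ₁ , μ₂ , agree-on-A , strong

theorem5 :
    (∀ {a} → ExcludedMiddle a) → (∀ {a b} → Extensionality a b) →
    ∀ {ℓ} (T : IndexTheory ℓ) → StrongAmalgamation ℓ (CARDC T)
theorem5 em ext T A M₁ M₂ A-model M₁-model M₂-model ι₁ ι₂
  with IndexTheory.strongAmalgamation T (Reduct.reduct T A) (Reduct.reduct T M₁) (Reduct.reduct T M₂)
         (satisfies (Reduct.reduct-model T A (satisfying A-model)))
         (satisfies (Reduct.reduct-model T M₁ (satisfying M₁-model)))
         (satisfies (Reduct.reduct-model T M₂ (satisfying M₂-model)))
         (Reduct.reduct-embedding T ι₁) (Reduct.reduct-embedding T ι₂)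
... | I , I-model , σ₁ , σ₂ , σ-agree , σ-strong =
      Amalgam.strong-amalgam em ext T
        (satisfying A-model) (satisfying M₁-model) (satisfying M₂-model) ι₁ ι₂
        (satisfying I-model) σ₁ σ₂ σ-agree σ-strong
        (CutFillingConstruction.cutFilling em ext T I (satisfying I-model))
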